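{- Let $G$ be a connected graph on $n \geq 3$ vertices with constant resistance curvature, and let $\mathcal{K}_G$ denote the common value of the resistance curvature at its vertices. Then $$\mathcal{K}_G \geq \frac{6}{n^2-1},$$ with equality if and only if $G = C_n$, the cycle on $n$ vertices.
   Context: All graphs are finite, simple and undirected. For a connected graph $G$ and vertices $i,j$, the resistance distance $\Omega_G(i,j)$ is the effective resistance between $i$ and $j$ in the electrical network obtained from $G$ by replacing each edge with a unit resistor. The resistance matrix $R_G$ is the $n\times n$ matrix with $(i,j)$-entry $\Omega_G(i,j)$; it is nonsingular. The resistance curvature vector $\kappa=(\kappa_1,\dots,\kappa_n)^T$ is the unique solution of $R_G\kappa=\mathbf{1}$, where $\mathbf{1}$ is the all-ones vector. $G$ has constant resistance curvature if all $\kappa_i$ are equal; this common value is denoted $\mathcal{K}_G$. -}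

module Defs where

open import Data.Nat as ℕ using (ℕ; zero; suc; _∸_)
open import Data.Fin using (Fin; zero; suc; toℕ; _≟_)
open import Data.Bool using (Bool; true; false; if_then_else_)
open import Data.Integer using (+_)
open import Data.Rational using (ℚ; _+_; _*_; _-_; _/_; 0ℚ; 1ℚ)
open import Data.Product using (Σ; _×_)
open import Data.Sum using (_⊎_)
open import Relation.Nullary using (does)
open import Relation.Binary.PropositionalEquality using (_≡_)

record Graph (n : ℕ) : Set where
  field
    adj    : Fin n → Fin n → Bool
    adj-sym : ∀ i j → adj i j ≡ adj j i
    irrefl : ∀ i → adj i i ≡ false
open Graph public

∑ : (n : ℕ) → (Fin n → ℚ) → ℚ
∑ zero    f = 0ℚ
∑ (suc n) f = f zero + ∑ n (λ i → f (suc i))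

data Reachable {n : ℕ} (G : Graph n) : Fin n → Fin n → Set where
  here : ∀ {i} → Reachable G i i
  step : ∀ {i j k} → adj G i j ≡ true → Reachable G j k → Reachable G i k

Connected : {n : ℕ} → Graph n → Set
Connected {n} G = ∀ (i j : Fin n) → Reachable G i j

laplacian : {n : ℕ} → Graph n → (Fin n → ℚ) → Fin n → ℚ
laplacian {n} G x i = ∑ n (λ j → if adj G i j then x i - x j else 0ℚ)

δ : {n : ℕ} → Fin n → Fin n → ℚ
δ i k = if does (i ≟ k) then 1ℚ else 0ℚ

-- Effective resistance (unit resistors): inject unit current at i, extract at j;
-- r is the resulting potential difference x_i - x_j, where L x = e_i - e_j.
IsResistance : {n : ℕ} → Graph n → Fin n → Fin n → ℚ → Set
IsResistance {n} G i j r =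
  Σ (Fin n → ℚ) λ x → (∀ k → laplacian G x k ≡ δ i k - δ j k) × (r ≡ x i - x j)

IsResistanceMatrix : {n : ℕ} → Graph n → (Fin n → Fin n → ℚ) → Set
IsResistanceMatrix G R = ∀ i j → IsResistance G i j (R i j)

IsCurvature : {n : ℕ} → (Fin n → Fin n → ℚ) → (Fin n → ℚ) → Set
IsCurvature {n} R κ = ∀ i → ∑ n (λ j → R i j * κ j) ≡ 1ℚ

CycSucc : (n : ℕ) → Fin n → Fin n → Set
CycSucc n a b = (toℕ b ≡ suc (toℕ a)) ⊎ ((suc (toℕ a) ≡ n) × (toℕ b ≡ 0))

CycAdj : (n : ℕ) → Fin n → Fin n → Set
CycAdj n a b = CycSucc n a b ⊎ CycSucc n b a

IsoToCycle : {n : ℕ} → Graph n → Set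
IsoToCycle {n} G =
  Σ (Fin n → Fin n) λ σ → Σ (Fin n → Fin n) λ τ →
    (∀ a → σ (τ a) ≡ a) × (∀ i → τ (σ i) ≡ i) ×
    (∀ i j → (adj G i j ≡ true → CycAdj n (σ i) (σ j)) × (CycAdj n (σ i) (σ j) → adj G i j ≡ true))

-- 6 / (n² - 1)  (only meaningful for n ≥ 2; set to 0 otherwise).
cycleBound : ℕ → ℚ
cycleBound (suc (suc k)) = (+ 6) / (suc (suc k) ℕ.* suc (suc k) ∸ 1)
cycleBound _ = 0ℚ

{-# OPTIONS --safe #-}
-- Let h i j = n Ω(i,j). Constant curvature means that the rows of R have a common sum T = 1/K, and
-- then h i is the potential with h i i = 0 and (L (h i)) j = 2 − 2 n δ i j. A cut vertex v is
-- impossible: comparing the currents of h v and h l through v shows that every component of G − v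
-- contains at least n/2 vertices. Hence two disjoint edges join any upper level set B of h i to its
-- complement (two edges at the single vertex if a side is a singleton). The current out of B is
-- 2 |B|, so the sum of the two smallest values on B exceeds that of the two largest values off B by
-- at most 2 |B|. Removing the vertices two at a time from the bottom gives
-- 6 ∑ⱼ h i j ≤ (n − 1) n (n + 1), that is, 6 T ≤ n² − 1. Equality leaves i with only two
-- neighbours, and a connected 2-regular graph is a cycle. On the cycle, h i j = d (n − d), where d
-- is the distance from i to j along the cycle.
module Submission where

open import Defs
open import Data.Nat using (ℕ; _≤_)
open import Data.Fin using (Fin)
open import Data.Rational using (ℚ) renaming (_≤_ to _≤ℚ_)
open import Data.Product using (_×_)
open import Relation.Binary.PropositionalEquality using (_≡_)

open import Data.Bool using (Bool; true; false; if_then_else_; not; _∧_)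
import Data.Bool.Properties as Boolₚ
open import Data.Empty using (⊥; ⊥-elim)
open import Data.Fin using (zero; suc; toℕ; fromℕ<; _≟_)
import Data.Fin.Properties as Finₚ
import Data.Integer as ℤ
import Data.Integer.Properties as ℤₚ
open import Data.Nat as ℕ using (zero; suc; z≤n; s≤s; _∸_)
import Data.Nat.Properties as ℕₚ
open import Data.Product using (Σ; ∃; _,_; proj₁; proj₂)
open import Data.Rational as ℚ using (0ℚ; 1ℚ; _+_; _*_; _-_; -_; _/_; _<_)
import Data.Rational.Properties as ℚₚ
open import Data.Rational.Unnormalised as ℚᵘ using (mkℚᵘ; *≡*)
import Data.Rational.Unnormalised.Properties as ℚᵘₚ
open import Data.Sum using (_⊎_; inj₁; inj₂; [_,_]′)
open import Function using (_∘_)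
open import Relation.Binary.PropositionalEquality using (_≢_; refl; sym; trans; cong; cong₂; subst; subst₂)
open import Relation.Nullary using (Dec; yes; no; does)
open import Relation.Nullary.Decidable using (dec⇒maybe; dec-true; dec-false; _×-dec_; ¬?)
open import Tactic.RingSolver using (solve-∀)
open import Tactic.RingSolver.Core.AlmostCommutativeRing using (AlmostCommutativeRing; fromCommutativeRing)

ℚ-ring : AlmostCommutativeRing _ _
ℚ-ring = fromCommutativeRing ℚₚ.+-*-commutativeRing (λ x → dec⇒maybe (0ℚ ℚ.≟ x))

-- Rational arithmetic

2ℚ 3ℚ 6ℚ : ℚ
2ℚ = 1ℚ + 1ℚ
3ℚ = 2ℚ + 1ℚ
6ℚ = 2ℚ + 2ℚ + 2ℚ

x≤y⇒0≤y-x : ∀ {x y} → x ≤ℚ y → 0ℚ ≤ℚ y - x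
x≤y⇒0≤y-x {x} {y} x≤y = subst (_≤ℚ y - x) (ℚₚ.+-inverseʳ x) (ℚₚ.+-monoˡ-≤ (- x) x≤y)

0≤y-x⇒x≤y : ∀ {x y} → 0ℚ ≤ℚ y - x → x ≤ℚ y
0≤y-x⇒x≤y {x} {y} p = subst₂ _≤ℚ_ (ℚₚ.+-identityˡ x) (eq y x) (ℚₚ.+-monoˡ-≤ x p)
  where
  eq : ∀ y x → y - x + x ≡ y
  eq = solve-∀ ℚ-ring

-- Reduces an inequality to a ring identity that displays the difference as a visibly nonnegative
-- expression; the `gap` identities below serve this purpose.
≤-from-gap : ∀ {x y d} → 0ℚ ≤ℚ d → y - x ≡ d → x ≤ℚ y
≤-from-gap 0≤d eq = 0≤y-x⇒x≤y (subst (0ℚ ≤ℚ_) (sym eq) 0≤d)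

+-nonneg : ∀ {x y} → 0ℚ ≤ℚ x → 0ℚ ≤ℚ y → 0ℚ ≤ℚ x + y
+-nonneg {x} {y} p q = subst (_≤ℚ x + y) (ℚₚ.+-identityˡ 0ℚ) (ℚₚ.+-mono-≤ p q)

*-nonneg : ∀ {x y} → 0ℚ ≤ℚ x → 0ℚ ≤ℚ y → 0ℚ ≤ℚ x * y
*-nonneg {x} {y} p q = subst (_≤ℚ x * y) (ℚₚ.*-zeroʳ x) (ℚₚ.*-monoˡ-≤-nonNeg x {{ℚ.nonNegative p}} q)

*-cancelˡ-≤ : ∀ {c x y} → 0ℚ < c → c * x ≤ℚ c * y → x ≤ℚ y
*-cancelˡ-≤ {c} 0<c = ℚₚ.*-cancelˡ-≤-pos c {{ℚ.positive 0<c}}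

*-cancelˡ-≡ : ∀ {c x y} → 0ℚ < c → c * x ≡ c * y → x ≡ y
*-cancelˡ-≡ 0<c eq = ℚₚ.≤-antisym (*-cancelˡ-≤ 0<c (ℚₚ.≤-reflexive eq)) (*-cancelˡ-≤ 0<c (ℚₚ.≤-reflexive (sym eq)))

0<1 : 0ℚ < 1ℚ
0<1 = ℚₚ.positive⁻¹ 1ℚ

0≤1 : 0ℚ ≤ℚ 1ℚ
0≤1 = ℚₚ.<⇒≤ 0<1

0<2 : 0ℚ < 2ℚ
0<2 = ℚₚ.positive⁻¹ 2ℚ

0≤2 : 0ℚ ≤ℚ 2ℚ
0≤2 = ℚₚ.<⇒≤ 0<2

-- The embedding of ℕ, by recursion so that `ι (suc n)` unfolds in step with `∑ (suc n)`.
ι : ℕ → ℚ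
ι zero    = 0ℚ
ι (suc n) = 1ℚ + ι n

0≤ι : ∀ n → 0ℚ ≤ℚ ι n
0≤ι zero    = ℚₚ.≤-refl
0≤ι (suc n) = +-nonneg 0≤1 (0≤ι n)

0<1+x : ∀ {x} → 0ℚ ≤ℚ x → 0ℚ < 1ℚ + x
0<1+x {x} 0≤x = ℚₚ.<-≤-trans 0<1 (subst (_≤ℚ 1ℚ + x) (ℚₚ.+-identityʳ 1ℚ) (ℚₚ.+-monoʳ-≤ 1ℚ 0≤x))

-- Finite sums

∑-cong : ∀ n {f g : Fin n → ℚ} → (∀ i → f i ≡ g i) → ∑ n f ≡ ∑ n g
∑-cong zero    eq = refl
∑-cong (suc n) eq = cong₂ _+_ (eq zero) (∑-cong n (eq ∘ suc))

∑-zero : ∀ n → ∑ n (λ _ → 0ℚ) ≡ 0ℚ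
∑-zero zero    = refl
∑-zero (suc n) = trans (ℚₚ.+-identityˡ _) (∑-zero n)

∑-distrib-+ : ∀ n (f g : Fin n → ℚ) → ∑ n (λ i → f i + g i) ≡ ∑ n f + ∑ n g
∑-distrib-+ zero    f g = refl
∑-distrib-+ (suc n) f g = trans (cong (f zero + g zero +_) (∑-distrib-+ n (f ∘ suc) (g ∘ suc)))
                                (interchange (f zero) (g zero) _ _)
  where
  interchange : ∀ a b c d → a + b + (c + d) ≡ a + c + (b + d)
  interchange = solve-∀ ℚ-ring

∑-distribˡ-* : ∀ n c (f : Fin n → ℚ) → ∑ n (λ i → c * f i) ≡ c * ∑ n f
∑-distribˡ-* zero    c f = sym (ℚₚ.*-zeroʳ c)
∑-distribˡ-* (suc n) c f = trans (cong (c * f zero +_) (∑-distribˡ-* n c (f ∘ suc)))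
                                 (sym (ℚₚ.*-distribˡ-+ c (f zero) (∑ n (f ∘ suc))))

∑-neg : ∀ n (f : Fin n → ℚ) → ∑ n (λ i → - f i) ≡ - ∑ n f
∑-neg zero    f = refl
∑-neg (suc n) f = trans (cong (- f zero +_) (∑-neg n (f ∘ suc))) (sym (ℚₚ.neg-distrib-+ (f zero) _))

∑-distrib-minus : ∀ n (f g : Fin n → ℚ) → ∑ n (λ i → f i - g i) ≡ ∑ n f - ∑ n g
∑-distrib-minus n f g = trans (∑-distrib-+ n f (λ i → - g i)) (cong (∑ n f +_) (∑-neg n g))

∑-const : ∀ n c → ∑ n (λ _ → c) ≡ ι n * c
∑-const zero    c = sym (ℚₚ.*-zeroˡ c)
∑-const (suc n) c = trans (cong (c +_) (∑-const n c)) (eq c (ι n))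
  where
  eq : ∀ c m → c + m * c ≡ (1ℚ + m) * c
  eq = solve-∀ ℚ-ring

∑-comm : ∀ m n (f : Fin m → Fin n → ℚ) → ∑ m (λ i → ∑ n (f i)) ≡ ∑ n (λ j → ∑ m (λ i → f i j))
∑-comm zero    n f = sym (∑-zero n)
∑-comm (suc m) n f = trans (cong (∑ n (f zero) +_) (∑-comm m n (f ∘ suc)))
                           (sym (∑-distrib-+ n (f zero) (λ j → ∑ m (λ i → f (suc i) j))))

∑-nonneg : ∀ n {f : Fin n → ℚ} → (∀ i → 0ℚ ≤ℚ f i) → 0ℚ ≤ℚ ∑ n f
∑-nonneg zero    p = ℚₚ.≤-refl
∑-nonneg (suc n) p = +-nonneg (p zero) (∑-nonneg n (p ∘ suc))

∑-mono : ∀ n {f g : Fin n → ℚ} → (∀ i → f i ≤ℚ g i) → ∑ n f ≤ℚ ∑ n g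
∑-mono zero    p = ℚₚ.≤-refl
∑-mono (suc n) p = ℚₚ.+-mono-≤ (p zero) (∑-mono n (p ∘ suc))

-- Exchanging the order of summation turns the sum into its own negative.
∑∑-antisym : ∀ n (f : Fin n → Fin n → ℚ) → (∀ i j → f i j ≡ - f j i) → ∑ n (λ i → ∑ n (f i)) ≡ 0ℚ
∑∑-antisym n f anti = *-cancelˡ-≡ {2ℚ} 0<2 (trans (double S) (trans (cong (S +_) S≡-S) (trans (ℚₚ.+-inverseʳ S) (sym (ℚₚ.*-zeroʳ 2ℚ)))))
  where
  S = ∑ n (λ i → ∑ n (f i))
  double : ∀ s → 2ℚ * s ≡ s + s
  double = solve-∀ ℚ-ring
  S≡-S : S ≡ - S
  S≡-S = trans (∑-cong n (λ i → ∑-cong n (anti i)))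
        (trans (∑-cong n (λ i → ∑-neg n (λ j → f j i)))
        (trans (∑-neg n (λ i → ∑ n (λ j → f j i)))
               (cong -_ (sym (∑-comm n n f)))))

δ-refl : ∀ {n} (i : Fin n) → δ i i ≡ 1ℚ
δ-refl i = cong (if_then 1ℚ else 0ℚ) (dec-true (i ≟ i) refl)

δ-≢ : ∀ {n} {i j : Fin n} → i ≢ j → δ i j ≡ 0ℚ
δ-≢ {i = i} {j} i≢j = cong (if_then 1ℚ else 0ℚ) (dec-false (i ≟ j) i≢j)

δ-sym : ∀ {n} (i j : Fin n) → δ i j ≡ δ j i
δ-sym i j with i ≟ j
... | yes refl = sym (δ-refl i)
... | no  i≢j  = sym (δ-≢ (i≢j ∘ sym))

0≤δ : ∀ {n} (i j : Fin n) → 0ℚ ≤ℚ δ i j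
0≤δ i j with does (i ≟ j)
... | true  = 0≤1
... | false = ℚₚ.≤-refl

∑-δ : ∀ n (i : Fin n) (f : Fin n → ℚ) → ∑ n (λ j → δ i j * f j) ≡ f i
∑-δ (suc n) zero f = trans (cong₂ _+_ (ℚₚ.*-identityˡ (f zero)) (trans (∑-cong n (λ j → ℚₚ.*-zeroˡ (f (suc j)))) (∑-zero n)))
                           (ℚₚ.+-identityʳ (f zero))
∑-δ (suc n) (suc i) f = trans (cong₂ _+_ (ℚₚ.*-zeroˡ (f zero)) (∑-δ n i (f ∘ suc))) (ℚₚ.+-identityˡ (f (suc i)))

∑-δ-1 : ∀ n (i : Fin n) → ∑ n (λ j → δ i j) ≡ 1ℚ
∑-δ-1 n i = trans (∑-cong n (λ j → sym (ℚₚ.*-identityʳ (δ i j)))) (∑-δ n i (λ _ → 1ℚ))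

-- For `c = 2 n` the second factor is the Laplacian of `h i`, so this evaluates the pairing of any
-- function with it.
∑-*-δ : ∀ n (i : Fin n) c (f : Fin n → ℚ) → ∑ n (λ j → f j * (2ℚ - c * δ i j)) ≡ 2ℚ * ∑ n f - c * f i
∑-*-δ n i c f = trans (∑-cong n (λ j → eq (f j) c (δ i j)))
  (trans (∑-distrib-minus n (λ j → 2ℚ * f j) (λ j → c * (δ i j * f j)))
         (cong₂ _-_ (∑-distribˡ-* n 2ℚ f) (trans (∑-distribˡ-* n c (λ j → δ i j * f j)) (cong (c *_) (∑-δ n i f)))))
  where
  eq : ∀ x c d → x * (2ℚ - c * d) ≡ 2ℚ * x - c * (d * x)
  eq = solve-∀ ℚ-ring

-- Expand `f (σ i)` as a sum against `δ (σ i)`, exchange the sums, and move the bijection across the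
-- delta.
∑-reindex : ∀ n (σ τ : Fin n → Fin n) → (∀ a → σ (τ a) ≡ a) → (∀ i → τ (σ i) ≡ i) →
            (f : Fin n → ℚ) → ∑ n (λ i → f (σ i)) ≡ ∑ n f
∑-reindex n σ τ στ τσ f =
  trans (∑-cong n (λ i → sym (∑-δ n (σ i) f)))
 (trans (∑-comm n n (λ i a → δ (σ i) a * f a))
        (∑-cong n (λ a → trans (∑-cong n (λ i → cong (_* f a) (δ-transport i a))) (∑-δ n (τ a) (λ _ → f a)))))
  where
  δ-transport : ∀ i a → δ (σ i) a ≡ δ (τ a) i
  δ-transport i a with τ a ≟ i
  ... | yes refl = trans (cong (λ b → δ b a) (στ a)) (δ-refl a)
  ... | no τa≢i = δ-≢ (λ σi≡a → τa≢i (trans (cong τ (sym σi≡a)) (τσ i)))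

-- The Laplacian

⟦_⟧ : Bool → ℚ
⟦ b ⟧ = if b then 1ℚ else 0ℚ

0≤⟦⟧ : ∀ b → 0ℚ ≤ℚ ⟦ b ⟧
0≤⟦⟧ true  = 0≤1
0≤⟦⟧ false = ℚₚ.≤-refl

if≡⟦⟧* : ∀ b x → (if b then x else 0ℚ) ≡ ⟦ b ⟧ * x
if≡⟦⟧* true  x = sym (ℚₚ.*-identityˡ x)
if≡⟦⟧* false x = sym (ℚₚ.*-zeroˡ x)

module _ {n : ℕ} (G : Graph n) where

  L : (Fin n → ℚ) → Fin n → ℚ
  L = laplacian G

  w : Fin n → Fin n → ℚ
  w i j = ⟦ adj G i j ⟧

  w-sym : ∀ i j → w i j ≡ w j i
  w-sym i j = cong ⟦_⟧ (adj-sym G i j)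

  -- Trades the conditional for a 0-1 weight, so that identities of summands become ring identities.
  L-weighted : ∀ x i → L x i ≡ ∑ n (λ j → w i j * (x i - x j))
  L-weighted x i = ∑-cong n (λ j → if≡⟦⟧* (adj G i j) (x i - x j))

  L-cong : ∀ {x y} → (∀ i → x i ≡ y i) → ∀ i → L x i ≡ L y i
  L-cong eq i = ∑-cong n (λ j → cong₂ (λ a b → if adj G i j then a - b else 0ℚ) (eq i) (eq j))

  L-+ : ∀ x y i → L (λ j → x j + y j) i ≡ L x i + L y i
  L-+ x y i = trans (L-weighted (λ j → x j + y j) i)
    (trans (∑-cong n (λ j → eq (w i j) (x i) (y i) (x j) (y j)))
    (trans (∑-distrib-+ n _ _) (sym (cong₂ _+_ (L-weighted x i) (L-weighted y i)))))
    where
    eq : ∀ c a b d e → c * (a + b - (d + e)) ≡ c * (a - d) + c * (b - e)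
    eq = solve-∀ ℚ-ring

  L-* : ∀ c x i → L (λ j → c * x j) i ≡ c * L x i
  L-* c x i = trans (L-weighted (λ j → c * x j) i)
    (trans (∑-cong n (λ j → eq (w i j) c (x i) (x j)))
    (trans (∑-distribˡ-* n c _) (cong (c *_) (sym (L-weighted x i)))))
    where
    eq : ∀ v c a b → v * (c * a - c * b) ≡ c * (v * (a - b))
    eq = solve-∀ ℚ-ring

  L-const : ∀ c i → L (λ _ → c) i ≡ 0ℚ
  L-const c i = trans (L-weighted (λ _ → c) i) (trans (∑-cong n (λ j → eq (w i j) c)) (∑-zero n))
    where
    eq : ∀ v c → v * (c - c) ≡ 0ℚ
    eq = solve-∀ ℚ-ring

  L-minus : ∀ x y i → L (λ j → x j - y j) i ≡ L x i - L y i
  L-minus x y i = trans (L-weighted (λ j → x j - y j) i)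
    (trans (∑-cong n (λ j → eq (w i j) (x i) (y i) (x j) (y j)))
    (trans (∑-distrib-minus n _ _) (sym (cong₂ _-_ (L-weighted x i) (L-weighted y i)))))
    where
    eq : ∀ c a b d e → c * (a - b - (d - e)) ≡ c * (a - d) - c * (b - e)
    eq = solve-∀ ℚ-ring

  L-∑ : ∀ m (x : Fin m → Fin n → ℚ) i → L (λ j → ∑ m (λ k → x k j)) i ≡ ∑ m (λ k → L (x k) i)
  L-∑ zero    x i = L-const 0ℚ i
  L-∑ (suc m) x i = trans (L-+ (x zero) _ i) (cong (L (x zero) i +_) (L-∑ m (x ∘ suc) i))

  private
    ∑*L : ∀ (x y : Fin n → ℚ) → ∑ n (λ i → y i * L x i) ≡ ∑ n (λ i → ∑ n (λ j → w i j * y i * (x i - x j)))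
    ∑*L x y = ∑-cong n (λ i → trans (cong (y i *_) (L-weighted x i))
      (trans (sym (∑-distribˡ-* n (y i) (λ j → w i j * (x i - x j)))) (∑-cong n (λ j → eq (y i) (w i j) (x i - x j)))))
      where
      eq : ∀ y v d → y * (v * d) ≡ v * y * d
      eq = solve-∀ ℚ-ring

    -- A sum over ordered pairs does not see an antisymmetric change of its summand.
    ∑∑-equal : ∀ (f g : Fin n → Fin n → ℚ) → (∀ i j → f i j - g i j ≡ - (f j i - g j i)) →
               ∑ n (λ i → ∑ n (f i)) ≡ ∑ n (λ i → ∑ n (g i))
    ∑∑-equal f g anti = trans (eq _ _) (trans (cong (_+ ∑ n (λ i → ∑ n (g i))) diff) (ℚₚ.+-identityˡ _))
      where
      eq : ∀ a b → a ≡ a - b + b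
      eq = solve-∀ ℚ-ring
      diff : ∑ n (λ i → ∑ n (f i)) - ∑ n (λ i → ∑ n (g i)) ≡ 0ℚ
      diff = trans (sym (∑-distrib-minus n _ _))
            (trans (∑-cong n (λ i → sym (∑-distrib-minus n (f i) (g i))))
                   (∑∑-antisym n (λ i j → f i j - g i j) anti))

  L-selfadjoint : ∀ x y → ∑ n (λ i → y i * L x i) ≡ ∑ n (λ i → x i * L y i)
  L-selfadjoint x y = trans (∑*L x y) (trans (∑∑-equal _ _ anti) (sym (∑*L y x)))
    where
    eq : ∀ v a b c d → v * b * (a - c) - v * a * (b - d) ≡ - (v * d * (c - a) - v * c * (d - b))
    eq = solve-∀ ℚ-ring
    anti : ∀ i j → w i j * y i * (x i - x j) - w i j * x i * (y i - y j) ≡ - (w j i * y j * (x j - x i) - w j i * x j * (y j - y i))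
    anti i j rewrite w-sym j i = eq (w i j) (x i) (y i) (x j) (y j)

  -- The discrete divergence theorem: an edge with both ends in `χ` is counted once in each
  -- direction and cancels, so only the edges leaving `χ` remain.
  flux : ∀ (χ : Fin n → Bool) x →
         ∑ n (λ i → ⟦ χ i ⟧ * L x i) ≡ ∑ n (λ i → ∑ n (λ j → w i j * (⟦ χ i ⟧ * (1ℚ - ⟦ χ j ⟧)) * (x i - x j)))
  flux χ x = trans (∑*L x (λ i → ⟦ χ i ⟧)) (∑∑-equal _ _ anti)
    where
    eq : ∀ v a b p q → v * p * (a - b) - v * (p * (1ℚ - q)) * (a - b) ≡ - (v * q * (b - a) - v * (q * (1ℚ - p)) * (b - a))
    eq = solve-∀ ℚ-ring
    anti : ∀ i j → w i j * ⟦ χ i ⟧ * (x i - x j) - w i j * (⟦ χ i ⟧ * (1ℚ - ⟦ χ j ⟧)) * (x i - x j)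
                 ≡ - (w j i * ⟦ χ j ⟧ * (x j - x i) - w j i * (⟦ χ j ⟧ * (1ℚ - ⟦ χ i ⟧)) * (x j - x i))
    anti i j rewrite w-sym j i = eq (w i j) (x i) (x j) ⟦ χ i ⟧ ⟦ χ j ⟧

-- Bounding a sum of nonnegative terms below by a few of its terms.

∑-dominates : ∀ n {c f : Fin n → ℚ} → (∀ i → c i ≤ℚ 1ℚ) → (∀ i → 0ℚ ≤ℚ f i) → ∑ n (λ i → c i * f i) ≤ℚ ∑ n f
∑-dominates n {c} {f} c≤1 0≤f =
  ∑-mono n (λ i → ≤-from-gap (*-nonneg (x≤y⇒0≤y-x (c≤1 i)) (0≤f i)) (eq (c i) (f i)))
  where
  eq : ∀ c x → x - c * x ≡ (1ℚ - c) * x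
  eq = solve-∀ ℚ-ring

δ≤1 : ∀ {n} (i k : Fin n) → δ i k ≤ℚ 1ℚ
δ≤1 i k with does (i ≟ k)
... | true  = ℚₚ.≤-refl
... | false = 0≤1

term≤∑ : ∀ n {f : Fin n → ℚ} → (∀ i → 0ℚ ≤ℚ f i) → ∀ i → f i ≤ℚ ∑ n f
term≤∑ n {f} 0≤f i = subst (_≤ℚ ∑ n f) (∑-δ n i f) (∑-dominates n (δ≤1 i) 0≤f)

-- Distinctness of the indices keeps the coefficient within what `∑-dominates` admits.
δ+δ≤1 : ∀ {n} {i j : Fin n} → i ≢ j → ∀ k → δ i k + δ j k ≤ℚ 1ℚ
δ+δ≤1 {i = i} {j} i≢j k with i ≟ k
... | no  _    = subst (_≤ℚ 1ℚ) (sym (ℚₚ.+-identityˡ (δ j k))) (δ≤1 j k)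
... | yes refl = ℚₚ.≤-reflexive (trans (cong (1ℚ +_) (δ-≢ (i≢j ∘ sym))) (ℚₚ.+-identityʳ 1ℚ))

two-terms≤∑ : ∀ n {f : Fin n → ℚ} → (∀ i → 0ℚ ≤ℚ f i) → ∀ {i j} → i ≢ j → f i + f j ≤ℚ ∑ n f
two-terms≤∑ n {f} 0≤f {i} {j} i≢j = subst (_≤ℚ ∑ n f) eq (∑-dominates n (δ+δ≤1 i≢j) 0≤f)
  where
  eq : ∑ n (λ k → (δ i k + δ j k) * f k) ≡ f i + f j
  eq = trans (∑-cong n (λ k → ℚₚ.*-distribʳ-+ (f k) (δ i k) (δ j k)))
      (trans (∑-distrib-+ n _ _) (cong₂ _+_ (∑-δ n i f) (∑-δ n j f)))

three-terms≤∑ : ∀ n {f : Fin n → ℚ} → (∀ i → 0ℚ ≤ℚ f i) → ∀ {i j k} → i ≢ j → i ≢ k → j ≢ k →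
                f i + f j + f k ≤ℚ ∑ n f
three-terms≤∑ n {f} 0≤f {i} {j} {k} i≢j i≢k j≢k = subst (_≤ℚ ∑ n f) eq (∑-dominates n bound 0≤f)
  where
  bound : ∀ l → δ i l + δ j l + δ k l ≤ℚ 1ℚ
  bound l with k ≟ l
  ... | no  _    = subst (_≤ℚ 1ℚ) (sym (ℚₚ.+-identityʳ _)) (δ+δ≤1 i≢j l)
  ... | yes refl = ℚₚ.≤-reflexive (cong (_+ 1ℚ) (cong₂ _+_ (δ-≢ i≢k) (δ-≢ j≢k)))
  eq : ∑ n (λ l → (δ i l + δ j l + δ k l) * f l) ≡ f i + f j + f k
  eq = trans (∑-cong n (λ l → distrib (δ i l) (δ j l) (δ k l) (f l)))
      (trans (∑-distrib-+ n _ _) (cong₂ _+_ (trans (∑-distrib-+ n _ _) (cong₂ _+_ (∑-δ n i f) (∑-δ n j f))) (∑-δ n k f)))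
    where
    distrib : ∀ a b c x → (a + b + c) * x ≡ a * x + b * x + c * x
    distrib = solve-∀ ℚ-ring

-- Entries in different rows are compared through their row sums; entries in one row must differ in
-- their column.
two-terms≤∑∑ : ∀ n {f : Fin n → Fin n → ℚ} → (∀ i j → 0ℚ ≤ℚ f i j) →
               ∀ {b₁ b₂ a₁ a₂} → a₁ ≢ a₂ ⊎ b₁ ≢ b₂ → f b₁ a₁ + f b₂ a₂ ≤ℚ ∑ n (λ i → ∑ n (f i))
two-terms≤∑∑ n 0≤f {b₁} {b₂} {a₁} {a₂} distinct with b₁ ≟ b₂
... | no b₁≢b₂ = ℚₚ.≤-trans (ℚₚ.+-mono-≤ (term≤∑ n (0≤f b₁) a₁) (term≤∑ n (0≤f b₂) a₂))
                            (two-terms≤∑ n (λ b → ∑-nonneg n (0≤f b)) b₁≢b₂)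
two-terms≤∑∑ n 0≤f {b₁} (inj₁ a₁≢a₂) | yes refl =
  ℚₚ.≤-trans (two-terms≤∑ n (0≤f b₁) a₁≢a₂) (term≤∑ n (λ b → ∑-nonneg n (0≤f b)) b₁)
two-terms≤∑∑ n 0≤f (inj₂ b₁≢b₂) | yes refl = ⊥-elim (b₁≢b₂ refl)

-- Subsets of Fin n as characteristic functions

module _ {n : ℕ} where

  card : (Fin n → Bool) → ℚ
  card χ = ∑ n (λ k → ⟦ χ k ⟧)

  card-zero : ∀ χ → card χ ≡ 0ℚ → ∀ k → χ k ≡ false
  card-zero χ eq k with χ k in χk
  ... | false = refl
  ... | true  = ⊥-elim (ℚₚ.<-irrefl refl (ℚₚ.<-≤-trans 0<1
    (subst₂ _≤ℚ_ (cong ⟦_⟧ χk) eq (term≤∑ n (λ j → 0≤⟦⟧ (χ j)) k))))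

  card-empty : ∀ χ → (∀ k → χ k ≡ false) → card χ ≡ 0ℚ
  card-empty χ empty = trans (∑-cong n (λ k → cong ⟦_⟧ (empty k))) (∑-zero n)

  _∖_ : (Fin n → Bool) → Fin n → Fin n → Bool
  (χ ∖ u) k = χ k ∧ not (does (u ≟ k))

  ∖-self : ∀ χ u → (χ ∖ u) u ≡ false
  ∖-self χ u = trans (cong (λ b → χ u ∧ not b) (dec-true (u ≟ u) refl)) (Boolₚ.∧-zeroʳ (χ u))

  ∖-other : ∀ χ {u k} → u ≢ k → (χ ∖ u) k ≡ χ k
  ∖-other χ {u} {k} u≢k = trans (cong (λ b → χ k ∧ not b) (dec-false (u ≟ k) u≢k)) (Boolₚ.∧-identityʳ (χ k))

  ∈∖⇒∈×≢ : ∀ χ {u k} → (χ ∖ u) k ≡ true → χ k ≡ true × u ≢ k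
  ∈∖⇒∈×≢ χ {u} {k} p with u ≟ k
  ... | no u≢k = trans (sym (Boolₚ.∧-identityʳ (χ k))) p , u≢k
  ... | yes _ with trans (sym (Boolₚ.∧-zeroʳ (χ k))) p
  ...   | ()

  ⟦∖⟧ : ∀ χ u → χ u ≡ true → ∀ k → ⟦ (χ ∖ u) k ⟧ ≡ ⟦ χ k ⟧ - δ u k
  ⟦∖⟧ χ u χu k with u ≟ k
  ... | yes refl rewrite χu = refl
  ... | no  _    = trans (cong ⟦_⟧ (Boolₚ.∧-identityʳ (χ k))) (eq ⟦ χ k ⟧)
    where
    eq : ∀ x → x ≡ x - 0ℚ
    eq = solve-∀ ℚ-ring

  ∑-∖ : ∀ χ u → χ u ≡ true → ∀ f → ∑ n (λ k → ⟦ (χ ∖ u) k ⟧ * f k) ≡ ∑ n (λ k → ⟦ χ k ⟧ * f k) - f u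
  ∑-∖ χ u χu f = trans (∑-cong n (λ k → trans (cong (_* f k) (⟦∖⟧ χ u χu k)) (eq ⟦ χ k ⟧ (δ u k) (f k))))
                (trans (∑-distrib-minus n _ _) (cong (λ z → ∑ n (λ k → ⟦ χ k ⟧ * f k) - z) (∑-δ n u f)))
    where
    eq : ∀ a b c → (a - b) * c ≡ a * c - b * c
    eq = solve-∀ ℚ-ring

  card-∖ : ∀ χ u → χ u ≡ true → card (χ ∖ u) ≡ card χ - 1ℚ
  card-∖ χ u χu = trans (∑-cong n (⟦∖⟧ χ u χu)) (trans (∑-distrib-minus n _ _) (cong (λ z → card χ - z) (∑-δ-1 n u)))

argmin : ∀ {n} (χ : Fin n → Bool) (f : Fin n → ℚ) →
         (∃ λ m → χ m ≡ true × (∀ k → χ k ≡ true → f m ≤ℚ f k)) ⊎ (∀ k → χ k ≡ false)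
argmin {zero} χ f = inj₂ λ ()
argmin {suc n} χ f with χ zero in χ0 | argmin (χ ∘ suc) (f ∘ suc)
... | false | inj₂ empty = inj₂ λ { zero → χ0 ; (suc k) → empty k }
... | false | inj₁ (m , χm , min) =
  inj₁ (suc m , χm , λ { zero χ0′ → ⊥-elim (Boolₚ.not-¬ χ0 χ0′) ; (suc k) → min k })
... | true | inj₂ empty =
  inj₁ (zero , χ0 , λ { zero _ → ℚₚ.≤-refl ; (suc k) χk → ⊥-elim (Boolₚ.not-¬ (empty k) χk) })
... | true | inj₁ (m , χm , min) with ℚₚ.≤-total (f zero) (f (suc m))
...   | inj₁ f0≤fm = inj₁ (zero , χ0 , λ { zero _ → ℚₚ.≤-refl ; (suc k) χk → ℚₚ.≤-trans f0≤fm (min k χk) })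
...   | inj₂ fm≤f0 = inj₁ (suc m , χm , λ { zero _ → fm≤f0 ; (suc k) → min k })

-- The minimum principle for the Laplacian.

module Minimum {n : ℕ} (G : Graph n) (connected : Connected G) where

  private
    -- At a minimiser `m` other than `j`, the nonnegative terms `w G m k * (y k - y m)` add up to
    -- `- L G y m`, which is at most 0. So every neighbour of `m` is a minimiser too, and minimality
    -- travels along the path to `j`.
    spread : ∀ {j y} → (∀ k → k ≢ j → 0ℚ ≤ℚ L G y k) →
             ∀ {m} → Reachable G m j → (∀ k → y m ≤ℚ y k) → ∀ k → y j ≤ℚ y k
    spread super here min = min
    spread {j} {y} super {m} (step {j = l} m~l path) min with m ≟ j
    ... | yes refl = min
    ... | no  m≢j  = spread super path (λ k → ℚₚ.≤-trans yl≤ym (min k))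
      where
      0≤term : ∀ k → 0ℚ ≤ℚ w G m k * (y k - y m)
      0≤term k = *-nonneg (0≤⟦⟧ (adj G m k)) (x≤y⇒0≤y-x (min k))
      eq : ∀ v a b → v * (b - a) ≡ - (v * (a - b))
      eq = solve-∀ ℚ-ring
      ∑≡-L : ∑ n (λ k → w G m k * (y k - y m)) ≡ - L G y m
      ∑≡-L = trans (∑-cong n (λ k → eq (w G m k) (y m) (y k))) (trans (∑-neg n _) (cong -_ (sym (L-weighted G y m))))
      term≤ : w G m l * (y l - y m) ≤ℚ - L G y m
      term≤ = subst (_ ≤ℚ_) ∑≡-L (term≤∑ n 0≤term l)
      yl≤ym : y l ≤ℚ y m
      yl≤ym = ≤-from-gap (+-nonneg (x≤y⇒0≤y-x (subst (λ b → ⟦ b ⟧ * (y l - y m) ≤ℚ - L G y m) m~l term≤)) (super m m≢j))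
                         (eq′ (y m) (y l) (L G y m))
        where
        eq′ : ∀ a b c → a - b ≡ - c - 1ℚ * (b - a) + c
        eq′ = solve-∀ ℚ-ring

  minimum-principle : ∀ {j y} → (∀ k → k ≢ j → 0ℚ ≤ℚ L G y k) → ∀ k → y j ≤ℚ y k
  minimum-principle {j} {y} super with argmin (λ _ → true) y
  ... | inj₁ (m , _ , min) = spread super (connected m j) (λ k → min k refl)
  ... | inj₂ empty with empty j
  ...   | ()

-- The cut vertex argument and the level sets of h i

-- Six times m² + (m − 2)² + (m − 4)² + ⋯.
cubic : ℚ → ℚ
cubic m = m * (m + 1ℚ) * (m + 2ℚ)

three-distinct : ∀ {n k} → n ≡ 3 ℕ.+ k → Σ (Fin n) λ x → Σ (Fin n) λ y → Σ (Fin n) λ z → x ≢ y × x ≢ z × y ≢ z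
three-distinct refl = zero , suc zero , suc (suc zero) , (λ ()) , (λ ()) , (λ ())

-- Keeping `n` a variable with an equation prevents `∑ n` and `ι n` from unfolding in the goals.
module Kernel {n k : ℕ} (n≡3+k : n ≡ 3 ℕ.+ k) (G : Graph n) (connected : Connected G)
  (h : Fin n → Fin n → ℚ)
  (h-diag : ∀ i → h i i ≡ 0ℚ) (h-sym : ∀ i j → h i j ≡ h j i)
  (L-h : ∀ i j → laplacian G (h i) j ≡ 2ℚ - 2ℚ * ι n * δ i j) where

  N : ℚ
  N = ι n

  open Minimum G connected

  0≤N : 0ℚ ≤ℚ N
  0≤N = 0≤ι n

  -- Away from `j`, the Laplacian of `h j - h v` is `2 n δ v`, which is nonnegative. By the minimum
  -- principle this function is least at `j`, and its values at `j` and `l` give the claim.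
  triangle : ∀ v j l → h v l ≤ℚ h v j + h j l
  triangle v j l = ≤-from-gap (x≤y⇒0≤y-x (minimum-principle {j} {y} super l)) gap
    where
    y : Fin n → ℚ
    y m = h j m - h v m
    eq : ∀ c d → 2ℚ - 2ℚ * c * 0ℚ - (2ℚ - 2ℚ * c * d) ≡ 2ℚ * c * d
    eq = solve-∀ ℚ-ring
    super : ∀ m → m ≢ j → 0ℚ ≤ℚ L G y m
    super m m≢j = subst (0ℚ ≤ℚ_)
      (sym (trans (L-minus G (h j) (h v) m)
           (trans (cong₂ _-_ (trans (L-h j m) (cong (λ d → 2ℚ - 2ℚ * N * d) (δ-≢ (m≢j ∘ sym)))) (L-h v m))
                  (eq N (δ v m)))))
      (*-nonneg (*-nonneg 0≤2 0≤N) (0≤δ v m))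
    eq′ : ∀ a b c → a + b - c ≡ b - c - (0ℚ - a)
    eq′ = solve-∀ ℚ-ring
    gap : h v j + h j l - h v l ≡ h j l - h v l - (h j j - h v j)
    gap = trans (eq′ (h v j) (h j l) (h v l)) (cong (λ z → h j l - h v l - (z - h v j)) (sym (h-diag j)))

  -- The triangle inequality from `i` to `j` and back bounds `2 h i j` below by `h i i = 0`.
  0≤h : ∀ i j → 0ℚ ≤ℚ h i j
  0≤h i j = *-cancelˡ-≤ {2ℚ} 0<2 (subst₂ _≤ℚ_ (trans (h-diag i) (sym (ℚₚ.*-zeroʳ 2ℚ)))
    (trans (cong (h i j +_) (h-sym j i)) (eq (h i j))) (triangle i j i))
    where
    eq : ∀ a → a + a ≡ 2ℚ * a
    eq = solve-∀ ℚ-ring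

  -- If `h i j` were at most 0, it would be a minimum of the nonnegative function `h i`, and the
  -- Laplacian there could not be 2.
  h-pos : ∀ {i j} → i ≢ j → 0ℚ < h i j
  h-pos {i} {j} i≢j with ℚₚ._≤?_ (h i j) 0ℚ
  ... | no  hij≰0 = ℚₚ.≰⇒> hij≰0
  ... | yes hij≤0 = ⊥-elim (ℚₚ.<-irrefl refl (ℚₚ.<-≤-trans 0<2 2≤0))
    where
    eq : ∀ v a b → 0ℚ - v * (a - b) ≡ v * (b - a)
    eq = solve-∀ ℚ-ring
    2≤0 : 2ℚ ≤ℚ 0ℚ
    2≤0 = subst₂ _≤ℚ_
      (trans (sym (L-weighted G (h i) j)) (trans (L-h i j) (trans (cong (λ d → 2ℚ - 2ℚ * N * d) (δ-≢ i≢j)) (eq′ N))))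
      (∑-zero n)
      (∑-mono n (λ l → ≤-from-gap (*-nonneg (0≤⟦⟧ (adj G j l)) (x≤y⇒0≤y-x (ℚₚ.≤-trans hij≤0 (0≤h i l))))
                                  (eq (w G j l) (h i j) (h i l))))
      where
      eq′ : ∀ c → 2ℚ - 2ℚ * c * 0ℚ ≡ 2ℚ
      eq′ = solve-∀ ℚ-ring

  ∑χL-h : ∀ χ i → ∑ n (λ b → ⟦ χ b ⟧ * L G (h i) b) ≡ 2ℚ * card χ - 2ℚ * N * ⟦ χ i ⟧
  ∑χL-h χ i = trans (∑-cong n (λ b → cong (⟦ χ b ⟧ *_) (L-h i b))) (∑-*-δ n i (2ℚ * N) (λ b → ⟦ χ b ⟧))

  flux-term : (Fin n → Bool) → (Fin n → ℚ) → Fin n → Fin n → ℚ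
  flux-term χ y b a = w G b a * (⟦ χ b ⟧ * (1ℚ - ⟦ χ a ⟧)) * (y b - y a)

  flux-term-crossing : ∀ χ y {b a} → adj G b a ≡ true → χ b ≡ true → χ a ≡ false → flux-term χ y b a ≡ y b - y a
  flux-term-crossing χ y {b} {a} b~a χb χa = trans
    (cong₂ (λ p q → ⟦ p ⟧ * q * (y b - y a)) b~a (cong₂ (λ p q → ⟦ p ⟧ * (1ℚ - ⟦ q ⟧)) χb χa))
    (ℚₚ.*-identityˡ (y b - y a))

  flux-term-nonneg : ∀ χ y → (∀ b a → adj G b a ≡ true → χ b ≡ true → χ a ≡ false → y a ≤ℚ y b) →
                     ∀ b a → 0ℚ ≤ℚ flux-term χ y b a
  flux-term-nonneg χ y downhill b a with adj G b a in b~a | χ b in χb | χ a in χa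
  ... | false | p     | q     = ℚₚ.≤-reflexive (eq (⟦ p ⟧ * (1ℚ - ⟦ q ⟧)) (y b - y a))
    where
    eq : ∀ p q → 0ℚ ≡ 0ℚ * p * q
    eq = solve-∀ ℚ-ring
  ... | true  | false | q     = ℚₚ.≤-reflexive (eq (1ℚ - ⟦ q ⟧) (y b - y a))
    where
    eq : ∀ p q → 0ℚ ≡ 1ℚ * (0ℚ * p) * q
    eq = solve-∀ ℚ-ring
  ... | true  | true  | true  = ℚₚ.≤-reflexive (sym (ℚₚ.*-zeroˡ (y b - y a)))
  ... | true  | true  | false = subst (0ℚ ≤ℚ_) (sym (ℚₚ.*-identityˡ (y b - y a))) (x≤y⇒0≤y-x (downhill b a b~a χb χa))

  -- The fluxes of h v and h l out of χ sum to 4 |χ| − 2 n, while each edge b v contributes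
  -- h v b + h l b − h l v ≥ 0.
  side-of-cut-vertex : ∀ χ v l → χ v ≡ false → χ l ≡ true →
    (∀ b a → adj G b a ≡ true → χ b ≡ true → χ a ≡ false → a ≡ v) → N ≤ℚ 2ℚ * card χ
  side-of-cut-vertex χ v l χv χl sep = *-cancelˡ-≤ {2ℚ} 0<2 (≤-from-gap 0≤flux (sym total))
    where
    y : Fin n → ℚ
    y b = h v b + h l b
    eq : ∀ x b c → x * (b + c) ≡ x * b + x * c
    eq = solve-∀ ℚ-ring
    eq₂ : ∀ c m → 2ℚ * c - 2ℚ * m * 0ℚ + (2ℚ * c - 2ℚ * m * 1ℚ) ≡ 2ℚ * (2ℚ * c) - 2ℚ * m
    eq₂ = solve-∀ ℚ-ring
    total : ∑ n (λ b → ⟦ χ b ⟧ * L G y b) ≡ 2ℚ * (2ℚ * card χ) - 2ℚ * N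
    total = trans (∑-cong n (λ b → trans (cong (⟦ χ b ⟧ *_) (L-+ G (h v) (h l) b)) (eq ⟦ χ b ⟧ (L G (h v) b) (L G (h l) b))))
           (trans (∑-distrib-+ n _ _)
           (trans (cong₂ _+_ (trans (∑χL-h χ v) (cong (λ b → 2ℚ * card χ - 2ℚ * N * ⟦ b ⟧) χv))
                             (trans (∑χL-h χ l) (cong (λ b → 2ℚ * card χ - 2ℚ * N * ⟦ b ⟧) χl)))
                  (eq₂ (card χ) N)))
    eq₃ : ∀ a b c → a + b - (0ℚ + c) ≡ b + a - c
    eq₃ = solve-∀ ℚ-ring
    downhill : ∀ b a → adj G b a ≡ true → χ b ≡ true → χ a ≡ false → y a ≤ℚ y b
    downhill b a b~a χb χa with sep b a b~a χb χa
    ... | refl = ≤-from-gap (x≤y⇒0≤y-x (subst (λ z → h l v ≤ℚ h l b + z) (h-sym b v) (triangle l b v)))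
      (trans (cong (λ z → h v b + h l b - (z + h l v)) (h-diag v)) (eq₃ (h v b) (h l b) (h l v)))
    0≤flux : 0ℚ ≤ℚ ∑ n (λ b → ⟦ χ b ⟧ * L G y b)
    0≤flux = subst (0ℚ ≤ℚ_) (sym (flux G χ y)) (∑-nonneg n (λ b → ∑-nonneg n (flux-term-nonneg χ y downhill b)))

  -- Pairs of edges crossing a cut.

  record CrossingEdge (χ : Fin n → Bool) : Set where
    field
      {a b} : Fin n
      edge : adj G a b ≡ true
      a∉ : χ a ≡ false
      b∈ : χ b ≡ true

  open CrossingEdge

  -- Otherwise `v` separates the rest of `χ` from the rest of its complement. Both parts are
  -- nonempty, by `b₀` and `a₀`, so each has at least n/2 vertices; yet together they have n - 1.
  crossing-edge-avoiding : ∀ χ v {a₀ b₀} → χ a₀ ≡ false → χ b₀ ≡ true → a₀ ≢ v → b₀ ≢ v →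
    Σ (CrossingEdge χ) λ e → a e ≢ v × b e ≢ v
  crossing-edge-avoiding χ v {a₀} {b₀} χa₀ χb₀ a₀≢v b₀≢v
    with Finₚ.any? (λ a → Finₚ.any? (λ b → (adj G a b Boolₚ.≟ true) ×-dec (χ a Boolₚ.≟ false) ×-dec
                                           (χ b Boolₚ.≟ true) ×-dec ¬? (a ≟ v) ×-dec ¬? (b ≟ v)))
  ... | yes (a , b , a~b , χa , χb , a≢v , b≢v) = record { edge = a~b ; a∉ = χa ; b∈ = χb } , a≢v , b≢v
  ... | no none = ⊥-elim (ℚₚ.<-irrefl refl (ℚₚ.<-≤-trans 0<2 2≤0))
    where
    B D : Fin n → Bool
    B = χ ∖ v
    D = (not ∘ χ) ∖ v
    sepB : ∀ b a → adj G b a ≡ true → B b ≡ true → B a ≡ false → a ≡ v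
    sepB b a b~a Bb Ba with a ≟ v
    ... | yes a≡v = a≡v
    ... | no  a≢v = let χb , v≢b = ∈∖⇒∈×≢ χ Bb in
      ⊥-elim (none (a , b , trans (adj-sym G a b) b~a , trans (sym (∖-other χ (a≢v ∘ sym))) Ba , χb , a≢v , v≢b ∘ sym))
    sepD : ∀ a b → adj G a b ≡ true → D a ≡ true → D b ≡ false → b ≡ v
    sepD a b a~b Da Db with b ≟ v
    ... | yes b≡v = b≡v
    ... | no  b≢v = let χa , v≢a = ∈∖⇒∈×≢ (not ∘ χ) Da in
      ⊥-elim (none (a , b , a~b , Boolₚ.not-injective χa ,
                    Boolₚ.not-injective (trans (sym (∖-other (not ∘ χ) (b≢v ∘ sym))) Db) , v≢a ∘ sym , b≢v))
    N≤B : N ≤ℚ 2ℚ * card B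
    N≤B = side-of-cut-vertex B v b₀ (∖-self χ v) (trans (∖-other χ (b₀≢v ∘ sym)) χb₀) sepB
    N≤D : N ≤ℚ 2ℚ * card D
    N≤D = side-of-cut-vertex D v a₀ (∖-self (not ∘ χ) v) (trans (∖-other (not ∘ χ) (a₀≢v ∘ sym)) (cong not χa₀)) sepD
    partition : ∀ l → ⟦ B l ⟧ + ⟦ D l ⟧ + δ v l ≡ 1ℚ
    partition l with v ≟ l | χ l
    ... | yes _ | true  = refl
    ... | yes _ | false = refl
    ... | no  _ | true  = refl
    ... | no  _ | false = refl
    B+D+1≡N : card B + card D + 1ℚ ≡ N
    B+D+1≡N = trans (cong₂ _+_ (sym (∑-distrib-+ n (λ l → ⟦ B l ⟧) (λ l → ⟦ D l ⟧))) (sym (∑-δ-1 n v)))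
             (trans (sym (∑-distrib-+ n (λ l → ⟦ B l ⟧ + ⟦ D l ⟧) (δ v)))
             (trans (∑-cong n partition) (trans (∑-const n 1ℚ) (ℚₚ.*-identityʳ N))))
    eq : ∀ x y → 0ℚ - 2ℚ ≡ 2ℚ * x - (x + y + 1ℚ) + (2ℚ * y - (x + y + 1ℚ))
    eq = solve-∀ ℚ-ring
    2≤0 : 2ℚ ≤ℚ 0ℚ
    2≤0 = ≤-from-gap (+-nonneg (x≤y⇒0≤y-x N≤B) (x≤y⇒0≤y-x N≤D))
      (trans (eq (card B) (card D)) (cong (λ z → 2ℚ * card B - z + (2ℚ * card D - z)) B+D+1≡N))

  -- The ends on a side are distinct unless that side is a singleton, which on the low side can only
  -- be the vertex `i`. The field `distinct` ensures that the flux counts the two edges separately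
  -- even then.
  record CrossingPair (χ : Fin n → Bool) (i : Fin n) : Set where
    field
      e₁ e₂ : CrossingEdge χ
      lower : a e₁ ≢ a e₂ ⊎ (∀ c → χ c ≡ false → c ≡ i)
      upper : b e₁ ≢ b e₂ ⊎ (∀ c → χ c ≡ true → c ≡ b e₁)
      distinct : a e₁ ≢ a e₂ ⊎ b e₁ ≢ b e₂

  another : ∀ (χ : Fin n → Bool) t i → (∃ λ c → χ c ≡ t × c ≢ i) ⊎ (∀ c → χ c ≡ t → c ≡ i)
  another χ t i with Finₚ.any? (λ c → (χ c Boolₚ.≟ t) ×-dec ¬? (c ≟ i))
  ... | yes p = inj₁ p
  ... | no none = inj₂ λ c χc → single c χc
    where
    single : ∀ c → χ c ≡ t → c ≡ i
    single c χc with c ≟ i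
    ... | yes c≡i = c≡i
    ... | no  c≢i = ⊥-elim (none (c , χc , c≢i))

  separated : ∀ {χ : Fin n → Bool} {a b} → χ a ≡ false → χ b ≡ true → a ≢ b
  separated χa χb refl = Boolₚ.not-¬ χa χb

  -- König's theorem for matchings of size two: no single vertex covers the crossing edges.
  crossing-pair : ∀ χ i b₀ → χ i ≡ false → χ b₀ ≡ true → CrossingPair χ i
  crossing-pair χ i b₀ χi χb₀ with another χ false i | another χ true b₀
  -- Two singleton sides would leave only the vertices `i` and `b₀`, but n is at least 3.
  ... | inj₂ onlyA | inj₂ onlyB = ⊥-elim (let x , y , z , x≢y , x≢z , y≢z = three-distinct n≡3+k in three-vertices x y z x≢y x≢z y≢z)
    where
    two : ∀ c → c ≡ i ⊎ c ≡ b₀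
    two c with χ c in χc
    ... | false = inj₁ (onlyA c χc)
    ... | true  = inj₂ (onlyB c χc)
    three-vertices : ∀ (x y z : Fin n) → x ≢ y → x ≢ z → y ≢ z → ⊥
    three-vertices x y z x≢y x≢z y≢z with two x | two y | two z
    ... | inj₁ p | inj₁ q | _      = x≢y (trans p (sym q))
    ... | inj₂ p | inj₂ q | _      = x≢y (trans p (sym q))
    ... | inj₁ p | inj₂ q | inj₁ r = x≢z (trans p (sym r))
    ... | inj₁ p | inj₂ q | inj₂ r = y≢z (trans q (sym r))
    ... | inj₂ p | inj₁ q | inj₁ r = y≢z (trans q (sym r))
    ... | inj₂ p | inj₁ q | inj₂ r = x≢z (trans p (sym r))
  ... | inj₂ onlyA | inj₁ (b* , χb* , b*≢b₀) =
    let e₁ , _ , b₁≢b₀ = crossing-edge-avoiding χ b₀ χi χb* (separated {χ} χi χb₀) b*≢b₀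
        e₂ , _ , b₂≢b₁ = crossing-edge-avoiding χ (b e₁) χi χb₀ (separated {χ} χi (b∈ e₁)) (b₁≢b₀ ∘ sym)
    in record { e₁ = e₁ ; e₂ = e₂ ; lower = inj₂ onlyA ; upper = inj₁ (b₂≢b₁ ∘ sym) ; distinct = inj₂ (b₂≢b₁ ∘ sym) }
  ... | inj₁ (a* , χa* , a*≢i) | inj₂ onlyB =
    let e₁ , a₁≢i , _ = crossing-edge-avoiding χ i χa* χb₀ a*≢i (separated {χ} χi χb₀ ∘ sym)
        e₂ , a₂≢a₁ , _ = crossing-edge-avoiding χ (a e₁) χi χb₀ (a₁≢i ∘ sym) (separated {χ} (a∉ e₁) χb₀ ∘ sym)
    in record { e₁ = e₁ ; e₂ = e₂ ; lower = inj₁ (a₂≢a₁ ∘ sym) ; distinct = inj₁ (a₂≢a₁ ∘ sym)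
              ; upper = inj₂ (λ c χc → trans (onlyB c χc) (sym (onlyB _ (b∈ e₁)))) }
  ... | inj₁ (a* , χa* , a*≢i) | inj₁ (b* , χb* , b*≢b₀) =
    matching (proj₁ (avoiding i)) (avoiding (a (proj₁ (avoiding i)))) (avoiding (b (proj₁ (avoiding i))))
    where
    -- When `v` is `i` or `b₀`, the second vertex on that side, `a*` or `b*`, takes its place.
    avoiding : ∀ v → Σ (CrossingEdge χ) λ e → a e ≢ v × b e ≢ v
    avoiding v with i ≟ v | b₀ ≟ v
    ... | no i≢v   | no b₀≢v  = crossing-edge-avoiding χ v χi χb₀ i≢v b₀≢v
    ... | no i≢v   | yes refl = crossing-edge-avoiding χ v χi χb* i≢v b*≢b₀
    ... | yes refl | no b₀≢v  = crossing-edge-avoiding χ v χa* χb₀ a*≢i b₀≢v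
    ... | yes refl | yes refl = ⊥-elim (separated {χ} χi χb₀ refl)
    disjoint : ∀ (e e′ : CrossingEdge χ) → a e ≢ a e′ → b e ≢ b e′ → CrossingPair χ i
    disjoint e e′ p q = record { e₁ = e ; e₂ = e′ ; lower = inj₁ p ; upper = inj₁ q ; distinct = inj₁ p }
    -- If neither `e′` nor `e″` is disjoint from `e`, then `e′` shares only the high end of `e` and
    -- `e″` only its low end, so `e′` and `e″` are disjoint from each other.
    matching : ∀ (e : CrossingEdge χ) → (Σ (CrossingEdge χ) λ e′ → a e′ ≢ a e × b e′ ≢ a e) →
               (Σ (CrossingEdge χ) λ e″ → a e″ ≢ b e × b e″ ≢ b e) → CrossingPair χ i
    matching e (e′ , a′≢a , _) (e″ , _ , b″≢b) with b e′ ≟ b e | a e″ ≟ a e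
    ... | no b′≢b  | _        = disjoint e e′ (a′≢a ∘ sym) (b′≢b ∘ sym)
    ... | yes _    | no a″≢a  = disjoint e e″ (a″≢a ∘ sym) (b″≢b ∘ sym)
    ... | yes b′≡b | yes a″≡a = disjoint e′ e″ (λ p → a′≢a (trans p a″≡a)) (λ p → b″≢b (trans (sym p) b′≡b))

  -- Summing the potential by removing lowest pairs.

  module Levels (i : Fin n) where

    f : Fin n → ℚ
    f = h i

    Upper : (Fin n → Bool) → Set
    Upper χ = ∀ a b → χ a ≡ false → χ b ≡ true → f a ≤ℚ f b

    -- `p` bounds the sum of the two largest values off `χ`; the condition is vacuous when the
    -- complement is a singleton.
    PairsBelow : (Fin n → Bool) → ℚ → Set
    PairsBelow χ p = ∀ a a′ → χ a ≡ false → χ a′ ≡ false → a ≢ a′ → f a + f a′ ≤ℚ p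

    -- Since `i` is not in `χ`, the flux of `f` out of `χ` is twice its size. All crossing edges run
    -- downhill, so the drops along two of them add up to at most that. A singleton low side is `i`
    -- itself, where `f` vanishes, and there `0 ≤ p` suffices.
    level-step : ∀ {χ p q b₀} → χ i ≡ false → χ b₀ ≡ true → Upper χ → 0ℚ ≤ℚ p → PairsBelow χ p →
      (∀ b b′ → χ b ≡ true → χ b′ ≡ true → b ≢ b′ ⊎ (∀ c → χ c ≡ true → c ≡ b) → q ≤ℚ f b + f b′) →
      q ≤ℚ p + 2ℚ * card χ
    level-step {χ} {p} {q} {b₀} χi χb₀ up 0≤p below above =
      ≤-from-gap (+-nonneg (+-nonneg (x≤y⇒0≤y-x low) (x≤y⇒0≤y-x through)) (x≤y⇒0≤y-x high))
                 (gap p q (f (a e₁)) (f (a e₂)) (f (b e₁)) (f (b e₂)) (2ℚ * card χ))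
      where
      open CrossingPair (crossing-pair χ i b₀ χi χb₀)
      gap : ∀ p q a₁ a₂ b₁ b₂ c → p + c - q ≡ p - (a₁ + a₂) + (c - (b₁ - a₁ + (b₂ - a₂))) + (b₁ + b₂ - q)
      gap = solve-∀ ℚ-ring
      low : f (a e₁) + f (a e₂) ≤ℚ p
      low with lower
      ... | inj₁ a₁≢a₂ = below _ _ (a∉ e₁) (a∉ e₂) a₁≢a₂
      ... | inj₂ only  = subst (_≤ℚ p) (sym (cong₂ _+_ (trans (cong f (only _ (a∉ e₁))) (h-diag i))
                                                      (trans (cong f (only _ (a∉ e₂))) (h-diag i)))) 0≤p
      high : q ≤ℚ f (b e₁) + f (b e₂)
      high = above _ _ (b∈ e₁) (b∈ e₂) upper
      term : ∀ e → flux-term χ f (b e) (a e) ≡ f (b e) - f (a e)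
      term e = flux-term-crossing χ f (trans (adj-sym G (b e) (a e)) (edge e)) (b∈ e) (a∉ e)
      eq : ∀ c m → 2ℚ * c - 2ℚ * m * 0ℚ ≡ 2ℚ * c
      eq = solve-∀ ℚ-ring
      through : f (b e₁) - f (a e₁) + (f (b e₂) - f (a e₂)) ≤ℚ 2ℚ * card χ
      through = subst₂ _≤ℚ_ (cong₂ _+_ (term e₁) (term e₂))
        (trans (sym (flux G χ f)) (trans (∑χL-h χ i) (trans (cong (λ z → 2ℚ * card χ - 2ℚ * N * ⟦ z ⟧) χi) (eq (card χ) N))))
        (two-terms≤∑∑ n (flux-term-nonneg χ f (λ b a _ χb χa → up a b χa χb)) distinct)

    ∑f : (Fin n → Bool) → ℚ
    ∑f χ = ∑ n (λ j → ⟦ χ j ⟧ * f j)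

    ∑f-empty : ∀ χ → (∀ j → χ j ≡ false) → ∑f χ ≡ 0ℚ
    ∑f-empty χ empty = trans (∑-cong n (λ j → trans (cong (λ z → ⟦ z ⟧ * f j) (empty j)) (ℚₚ.*-zeroˡ (f j)))) (∑-zero n)

    card-pred : ∀ (χ : Fin n → Bool) u {m} → χ u ≡ true → card χ ≡ 1ℚ + m → card (χ ∖ u) ≡ m
    card-pred χ u {m} χu eq = trans (card-∖ χ u χu) (trans (cong (_- 1ℚ) eq) (cancel m))
      where
      cancel : ∀ m → 1ℚ + m - 1ℚ ≡ m
      cancel = solve-∀ ℚ-ring

    least : ∀ χ m → card χ ≡ ι (suc m) → ∃ λ u → χ u ≡ true × (∀ j → χ j ≡ true → f u ≤ℚ f j)
    least χ m eq with argmin χ f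
    ... | inj₁ found = found
    ... | inj₂ empty = ⊥-elim (ℚₚ.<-irrefl refl (subst (0ℚ <_) (trans (sym eq) (card-empty χ empty)) (0<1+x (0≤ι m))))

    -- Here `m` counts the vertices left after `u` and `v` are removed. `bound` is the estimate for
    -- those, with `p = f u + f v`, after adding `6 (f u + f v)` to both sides.
    record LowestPair (χ : Fin n → Bool) (m : ℚ) : Set where
      field
        u v     : Fin n
        u∈      : χ u ≡ true
        v∈      : χ v ≡ true
        minimal : ∀ b b′ → χ b ≡ true → χ b′ ≡ true → b ≢ b′ → f u + f v ≤ℚ f b + f b′
        bound   : 6ℚ * ∑f χ ≤ℚ 3ℚ * (2ℚ + m) * (f u + f v) + cubic m

    module RemovePair (χ : Fin n → Bool) (χi : χ i ≡ false) (up : Upper χ)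
      (u : Fin n) (χu : χ u ≡ true) (u-min : ∀ j → χ j ≡ true → f u ≤ℚ f j)
      (v : Fin n) (χ′v : (χ ∖ u) v ≡ true) (v-min : ∀ j → (χ ∖ u) j ≡ true → f v ≤ℚ f j) where

      χ′ : Fin n → Bool
      χ′ = χ ∖ u
      χv : χ v ≡ true
      χv = proj₁ (∈∖⇒∈×≢ χ {u} χ′v)
      χ″ : Fin n → Bool
      χ″ = χ′ ∖ v
      minimal : ∀ b b′ → χ b ≡ true → χ b′ ≡ true → b ≢ b′ → f u + f v ≤ℚ f b + f b′
      minimal b b′ χb χb′ b≢b′ with u ≟ b
      ... | yes refl = ℚₚ.+-monoʳ-≤ (f u) (v-min b′ (trans (∖-other χ b≢b′) χb′))
      ... | no u≢b   = subst (f u + f v ≤ℚ_) (ℚₚ.+-comm (f b′) (f b))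
                         (ℚₚ.+-mono-≤ (u-min b′ χb′) (v-min b (trans (∖-other χ u≢b) χb)))
      classify : ∀ c → χ″ c ≡ false → c ≡ u ⊎ c ≡ v ⊎ χ c ≡ false
      classify c χ″c with u ≟ c | v ≟ c
      ... | yes u≡c | _       = inj₁ (sym u≡c)
      ... | no _    | yes v≡c = inj₂ (inj₁ (sym v≡c))
      ... | no _    | no _    =
        inj₂ (inj₂ (trans (sym (trans (Boolₚ.∧-identityʳ (χ c ∧ true)) (Boolₚ.∧-identityʳ (χ c)))) χ″c))
      up″ : Upper χ″
      up″ c b χ″c χ″b with ∈∖⇒∈×≢ χ′ {v} χ″b
      ... | χ′b , _ with ∈∖⇒∈×≢ χ {u} χ′b | classify c χ″c
      ...   | χb , _ | inj₁ refl        = u-min b χb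
      ...   | χb , _ | inj₂ (inj₁ refl) = v-min b χ′b
      ...   | χb , _ | inj₂ (inj₂ χc)   = up c b χc χb
      swap≤ : ∀ x y {z} → f x + f y ≤ℚ z → f y + f x ≤ℚ z
      swap≤ x y {z} = subst (_≤ℚ z) (ℚₚ.+-comm (f x) (f y))
      -- Off `χ″` lie `u`, `v` and the vertices off `χ`, whose values exceed neither `f u` nor
      -- `f v`.
      below″ : PairsBelow χ″ (f u + f v)
      below″ c d χ″c χ″d c≢d with classify c χ″c | classify d χ″d
      ... | inj₁ refl        | inj₁ refl        = ⊥-elim (c≢d refl)
      ... | inj₁ refl        | inj₂ (inj₁ refl) = ℚₚ.≤-refl
      ... | inj₁ refl        | inj₂ (inj₂ χd)   = ℚₚ.+-monoʳ-≤ (f u) (up d v χd χv)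
      ... | inj₂ (inj₁ refl) | inj₁ refl        = swap≤ u v ℚₚ.≤-refl
      ... | inj₂ (inj₁ refl) | inj₂ (inj₁ refl) = ⊥-elim (c≢d refl)
      ... | inj₂ (inj₁ refl) | inj₂ (inj₂ χd)   = swap≤ d v (ℚₚ.+-monoˡ-≤ (f v) (up d u χd χu))
      ... | inj₂ (inj₂ χc)   | inj₁ refl        = swap≤ u c (ℚₚ.+-monoʳ-≤ (f u) (up c v χc χv))
      ... | inj₂ (inj₂ χc)   | inj₂ (inj₁ refl) = ℚₚ.+-monoˡ-≤ (f v) (up c u χc χu)
      ... | inj₂ (inj₂ χc)   | inj₂ (inj₂ χd)   = ℚₚ.+-mono-≤ (up c u χc χu) (up d v χd χv)
      χ″i : χ″ i ≡ false
      χ″i = cong (λ z → (z ∧ not (does (u ≟ i))) ∧ not (does (v ≟ i))) χi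
      eq : ∀ s a b → s ≡ s - a - b + a + b
      eq = solve-∀ ℚ-ring
      ∑f≡ : ∑f χ ≡ ∑f χ″ + f v + f u
      ∑f≡ = trans (eq (∑f χ) (f u) (f v))
           (trans (regroup (∑f χ - f u - f v) (f u) (f v))
                  (cong (λ z → z + f v + f u) (sym (trans (∑-∖ χ′ v χ′v f) (cong (_- f v) (∑-∖ χ u χu f))))))
        where
        regroup : ∀ s a b → s + a + b ≡ s + b + a
        regroup = solve-∀ ℚ-ring

    mutual

      -- Stated apart from `upper-sum` because the equality case needs the bound in terms of
      -- `f u + f v`, before `level-step` replaces that sum. Each round of the mutual recursion
      -- lowers the size by two.
      lowest-pair : ∀ m χ → χ i ≡ false → card χ ≡ ι (2 ℕ.+ m) → Upper χ → LowestPair χ (ι m)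
      lowest-pair m χ χi card≡ up =
        let u , χu , u-min = least χ (suc m) card≡
            card′ = card-pred χ u χu card≡
            v , χ′v , v-min = least (χ ∖ u) m card′
        in remove-pair m χ χi up u χu u-min v χ′v v-min (card-pred (χ ∖ u) v χ′v card′)

      remove-pair : ∀ m χ → χ i ≡ false → Upper χ →
        ∀ u → χ u ≡ true → (∀ j → χ j ≡ true → f u ≤ℚ f j) →
        ∀ v → (χ ∖ u) v ≡ true → (∀ j → (χ ∖ u) j ≡ true → f v ≤ℚ f j) →
        card ((χ ∖ u) ∖ v) ≡ ι m → LowestPair χ (ι m)
      remove-pair m χ χi up u χu u-min v χ′v v-min card″ = record
        { u = u ; v = v ; u∈ = χu ; v∈ = χv ; minimal = minimal
        ; bound = ≤-from-gap (x≤y⇒0≤y-x ih) (trans (cong (λ z → 3ℚ * (2ℚ + ι m) * (f u + f v) + cubic (ι m) - 6ℚ * z) ∑f≡)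
                                                   (gap (ι m) (f u) (f v) (∑f χ″) (cubic (ι m)))) }
        where
        open RemovePair χ χi up u χu u-min v χ′v v-min
        ih : 6ℚ * ∑f χ″ ≤ℚ 3ℚ * ι m * (f u + f v) + cubic (ι m)
        ih = upper-sum m χ″ χ″i card″ up″ (+-nonneg (0≤h i u) (0≤h i v)) below″
        gap : ∀ m a b s c → 3ℚ * (2ℚ + m) * (a + b) + c - 6ℚ * (s + b + a) ≡ 3ℚ * m * (a + b) + c - 6ℚ * s
        gap = solve-∀ ℚ-ring

      -- Write M for the size and q for the sum of the two least values on `χ`. Then `level-step`
      -- gives q ≤ p + 2 M, the lowest pair gives the bound 3 M q + cubic (M - 2), and cubic M -
      -- cubic (M - 2) = 6 M².
      upper-sum : ∀ m χ {p} → χ i ≡ false → card χ ≡ ι m → Upper χ → 0ℚ ≤ℚ p → PairsBelow χ p →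
                  6ℚ * ∑f χ ≤ℚ 3ℚ * ι m * p + cubic (ι m)
      upper-sum zero χ {p} χi card≡ up 0≤p below =
        ℚₚ.≤-reflexive (trans (cong (6ℚ *_) (∑f-empty χ (card-zero χ card≡))) (eq p))
        where
        eq : ∀ p → 6ℚ * 0ℚ ≡ 3ℚ * 0ℚ * p + 0ℚ * (0ℚ + 1ℚ) * (0ℚ + 2ℚ)
        eq = solve-∀ ℚ-ring
      -- With one vertex left, both crossing edges end at it, so `2 f u ≤ p + 2`; three times this
      -- is the claim.
      upper-sum (suc zero) χ {p} χi card≡ up 0≤p below with least χ 0 card≡
      ... | u , χu , u-min = ≤-from-gap (*-nonneg 0≤3 (x≤y⇒0≤y-x 2fu≤p+2))
              (trans (cong (λ z → 3ℚ * (1ℚ + 0ℚ) * p + cubic (1ℚ + 0ℚ) - 6ℚ * z) ∑f≡) (gap p (f u)))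
        where
        0≤3 : 0ℚ ≤ℚ 3ℚ
        0≤3 = +-nonneg 0≤2 0≤1
        2fu≤p+2 : f u + f u ≤ℚ p + 2ℚ * (1ℚ + 0ℚ)
        2fu≤p+2 = subst (λ z → f u + f u ≤ℚ p + 2ℚ * z) card≡
          (level-step χi χu up 0≤p below (λ b b′ χb χb′ _ → ℚₚ.+-mono-≤ (u-min b χb) (u-min b′ χb′)))
        eq : ∀ s a → s ≡ s - a + a
        eq = solve-∀ ℚ-ring
        ∑f≡ : ∑f χ ≡ f u
        ∑f≡ = trans (eq (∑f χ) (f u)) (trans (cong (_+ f u) (trans (sym (∑-∖ χ u χu f))
                (∑f-empty (χ ∖ u) (card-zero (χ ∖ u) (card-pred χ u χu card≡))))) (ℚₚ.+-identityˡ (f u)))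
        gap : ∀ p a → 3ℚ * (1ℚ + 0ℚ) * p + (1ℚ + 0ℚ) * (1ℚ + 0ℚ + 1ℚ) * (1ℚ + 0ℚ + 2ℚ) - 6ℚ * a ≡ 3ℚ * (p + 2ℚ * (1ℚ + 0ℚ) - (a + a))
        gap = solve-∀ ℚ-ring
      upper-sum (suc (suc m)) χ {p} χi card≡ up 0≤p below =
        ≤-from-gap (+-nonneg (*-nonneg 0≤c (x≤y⇒0≤y-x q≤)) (x≤y⇒0≤y-x bound)) (gap (ι m) p (f u + f v) (6ℚ * ∑f χ))
        where
        open LowestPair (lowest-pair m χ χi card≡ up)
        0≤c : 0ℚ ≤ℚ 3ℚ * (2ℚ + ι m)
        0≤c = *-nonneg (+-nonneg 0≤2 0≤1) (+-nonneg 0≤2 (0≤ι m))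
        above : ∀ b b′ → χ b ≡ true → χ b′ ≡ true → b ≢ b′ ⊎ (∀ c → χ c ≡ true → c ≡ b) → f u + f v ≤ℚ f b + f b′
        above b b′ χb χb′ (inj₁ b≢b′) = minimal b b′ χb χb′ b≢b′
        -- Were `χ` a singleton, all four vertices would coincide and the two sums would agree; no
        -- contradiction has to be derived.
        above b b′ χb χb′ (inj₂ only) = ℚₚ.≤-reflexive (cong₂ _+_ (cong f (only u u∈)) (cong f (trans (only v v∈) (sym (only b′ χb′)))))
        q≤ : f u + f v ≤ℚ p + 2ℚ * (1ℚ + (1ℚ + ι m))
        q≤ = subst (λ z → f u + f v ≤ℚ p + 2ℚ * z) card≡ (level-step χi u∈ up 0≤p below above)
        gap : ∀ m p q s → 3ℚ * (1ℚ + (1ℚ + m)) * p + (1ℚ + (1ℚ + m)) * (1ℚ + (1ℚ + m) + 1ℚ) * (1ℚ + (1ℚ + m) + 2ℚ) - s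
                        ≡ 3ℚ * (2ℚ + m) * (p + 2ℚ * (1ℚ + (1ℚ + m)) - q) + (3ℚ * (2ℚ + m) * q + m * (m + 1ℚ) * (m + 2ℚ) - s)
        gap = solve-∀ ℚ-ring

    -- The bound on the total of `h i`, and its equality case.

    others : Fin n → Bool
    others = (λ _ → true) ∖ i

    ∉others⇒≡i : ∀ {c} → others c ≡ false → c ≡ i
    ∉others⇒≡i {c} p with i ≟ c
    ... | yes i≡c = sym i≡c
    ∉others⇒≡i {c} () | no _

    N≡ : N ≡ 1ℚ + ι (2 ℕ.+ k)
    N≡ = cong ι n≡3+k

    card-others : card others ≡ ι (2 ℕ.+ k)
    card-others = card-pred (λ _ → true) i refl (trans (trans (∑-const n 1ℚ) (ℚₚ.*-identityʳ N)) N≡)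

    ∑f-others : ∑f others ≡ ∑ n f
    ∑f-others = trans (∑-∖ (λ _ → true) i refl f)
               (trans (cong₂ _-_ (∑-cong n (λ j → ℚₚ.*-identityˡ (f j))) (h-diag i)) (eq (∑ n f)))
      where
      eq : ∀ x → x - 0ℚ ≡ x
      eq = solve-∀ ℚ-ring

    others-upper : Upper others
    others-upper a b a∉ _ = subst (_≤ℚ f b) (sym (trans (cong f (∉others⇒≡i a∉)) (h-diag i))) (0≤h i b)

    -- Start from all vertices but `i`. The complement contains no pair, so `p = 0` is allowed.
    total≤ : 6ℚ * ∑ n f ≤ℚ cubic (ι (2 ℕ.+ k))
    total≤ = subst₂ _≤ℚ_ (cong (6ℚ *_) ∑f-others) (eq (ι (2 ℕ.+ k)) (cubic (ι (2 ℕ.+ k))))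
      (upper-sum (2 ℕ.+ k) others (∖-self (λ _ → true) i) card-others others-upper ℚₚ.≤-refl
                 (λ a a′ p q a≢a′ → ⊥-elim (a≢a′ (trans (∉others⇒≡i p) (sym (∉others⇒≡i q))))))
      where
      eq : ∀ m c → 3ℚ * m * 0ℚ + c ≡ c
      eq = solve-∀ ℚ-ring

    -- A crossing pair for `others` has both low ends at `i`, so its high ends must differ.
    two-neighbours : Σ (Fin n) λ x → Σ (Fin n) λ y → adj G i x ≡ true × adj G i y ≡ true × x ≢ y
    two-neighbours = b e₁ , b e₂ , at-i e₁ , at-i e₂ , [ (λ a₁≢a₂ → ⊥-elim (a₁≢a₂ (trans (a≡i e₁) (sym (a≡i e₂))))) , (λ p → p) ]′ distinct
      where
      other = least others (suc k) card-others
      open CrossingPair (crossing-pair others i (proj₁ other) (∖-self (λ _ → true) i) (proj₁ (proj₂ other)))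
      a≡i : ∀ (e : CrossingEdge others) → a e ≡ i
      a≡i e = ∉others⇒≡i (a∉ e)
      at-i : ∀ (e : CrossingEdge others) → adj G i (b e) ≡ true
      at-i e = subst (λ c → adj G c (b e) ≡ true) (a≡i e) (edge e)

    -- This is the Laplacian equation of `h i` at `i`, where `h i` vanishes: the current 2 n - 2
    -- leaves through the neighbours.
    ∑-neighbours : ∑ n (λ j → w G i j * f j) ≡ 2ℚ * ι (2 ℕ.+ k)
    ∑-neighbours = trans (∑-cong n (λ j → trans (eq₁ (w G i j) (f j)) (cong (λ z → - (w G i j * (z - f j))) (sym (h-diag i)))))
      (trans (∑-neg n _) (trans (cong -_ (trans (sym (L-weighted G f i)) (L-h i i)))
      (trans (cong₂ (λ m d → - (2ℚ - 2ℚ * m * d)) N≡ (δ-refl i)) (eq₂ (ι (2 ℕ.+ k))))))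
      where
      eq₁ : ∀ v x → v * x ≡ - (v * (0ℚ - x))
      eq₁ = solve-∀ ℚ-ring
      eq₂ : ∀ m → - (2ℚ - 2ℚ * (1ℚ + m) * 1ℚ) ≡ 2ℚ * m
      eq₂ = solve-∀ ℚ-ring

    -- Equality makes the two least values off `i` add up to at least 2 (n - 1). The values at three
    -- neighbours add up to at most 2 (n - 1), so the third would be at most 0, against `h-pos`.
    at-most-two-neighbours : 6ℚ * ∑ n f ≡ cubic (ι (2 ℕ.+ k)) →
      ∀ {x y z} → adj G i x ≡ true → adj G i y ≡ true → adj G i z ≡ true → x ≢ y → x ≢ z → y ≢ z → ⊥
    at-most-two-neighbours tight {x} {y} {z} i~x i~y i~z x≢y x≢z y≢z =
      ℚₚ.<-irrefl refl (ℚₚ.<-≤-trans (h-pos (neighbour≢ i~z)) fz≤0)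
      where
      open LowestPair (lowest-pair k others (∖-self (λ _ → true) i) card-others others-upper)
      m = ι k
      neighbour≢ : ∀ {c} → adj G i c ≡ true → i ≢ c
      neighbour≢ i~c refl = Boolₚ.not-¬ (irrefl G i) i~c
      in-others : ∀ {c} → adj G i c ≡ true → others c ≡ true
      in-others i~c = ∖-other (λ _ → true) (neighbour≢ i~c)
      0<c : 0ℚ < 3ℚ * (1ℚ + (1ℚ + m))
      0<c = subst (_< 3ℚ * (1ℚ + (1ℚ + m))) (ℚₚ.*-zeroʳ 3ℚ)
        (ℚₚ.*-monoʳ-<-pos 3ℚ (0<1+x (+-nonneg 0≤1 (0≤ι k))))
      gap : ∀ m q → 3ℚ * (1ℚ + (1ℚ + m)) * q - 3ℚ * (1ℚ + (1ℚ + m)) * (2ℚ * (1ℚ + (1ℚ + m)))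
                      ≡ 3ℚ * (2ℚ + m) * q + m * (m + 1ℚ) * (m + 2ℚ)
                        - (1ℚ + (1ℚ + m)) * (1ℚ + (1ℚ + m) + 1ℚ) * (1ℚ + (1ℚ + m) + 2ℚ)
      gap = solve-∀ ℚ-ring
      -- With M = n - 1, tightness turns `bound` into 6 M² ≤ 3 M (f u + f v), again because cubic M
      -- - cubic (M - 2) = 6 M²; then cancel 3 M.
      2m≤q : 2ℚ * ι (2 ℕ.+ k) ≤ℚ f u + f v
      2m≤q = *-cancelˡ-≤ 0<c (≤-from-gap
        (x≤y⇒0≤y-x (subst (_≤ℚ 3ℚ * (2ℚ + m) * (f u + f v) + cubic m) (trans (cong (6ℚ *_) ∑f-others) tight) bound))
        (gap m (f u + f v)))
      term : ∀ {c} → adj G i c ≡ true → w G i c * f c ≡ f c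
      term {c} i~c = trans (cong (λ e → ⟦ e ⟧ * f c) i~c) (ℚₚ.*-identityˡ (f c))
      three≤ : f x + f y + f z ≤ℚ 2ℚ * ι (2 ℕ.+ k)
      three≤ = subst₂ _≤ℚ_ (cong₂ _+_ (cong₂ _+_ (term i~x) (term i~y)) (term i~z)) ∑-neighbours
        (three-terms≤∑ n (λ j → *-nonneg (0≤⟦⟧ (adj G i j)) (0≤h i j)) x≢y x≢z y≢z)
      gap′ : ∀ a b c q → 0ℚ - c ≡ q - (a + b + c) + (a + b - q)
      gap′ = solve-∀ ℚ-ring
      fz≤0 : f z ≤ℚ 0ℚ
      fz≤0 = ≤-from-gap (+-nonneg (x≤y⇒0≤y-x (ℚₚ.≤-trans three≤ 2m≤q))
                                  (x≤y⇒0≤y-x (minimal x y (in-others i~x) (in-others i~y) x≢y)))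
                        (gap′ (f x) (f y) (f z) (f u + f v))

-- Connected 2-regular graphs

module TwoRegular {n : ℕ} (G : Graph n) (connected : Connected G) (o : Fin n)
  (two : ∀ i → Σ (Fin n) λ x → Σ (Fin n) λ y → adj G i x ≡ true × adj G i y ≡ true × x ≢ y)
  (at-most-two : ∀ i {x y z} → adj G i x ≡ true → adj G i y ≡ true → adj G i z ≡ true →
                 x ≢ y → x ≢ z → y ≢ z → ⊥) where

  other : ∀ i x → Σ (Fin n) λ y → adj G i y ≡ true × y ≢ x
  other i x with two i
  ... | y , z , i~y , i~z , y≢z with y ≟ x
  ...   | no  y≢x  = y , i~y , y≢x
  ...   | yes refl = z , i~z , y≢z ∘ sym

  other-unique : ∀ i {x y z} → adj G i x ≡ true → adj G i y ≡ true → x ≢ y → adj G i z ≡ true → z ≡ x ⊎ z ≡ y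
  other-unique i {x} {y} {z} i~x i~y x≢y i~z with z ≟ x | z ≟ y
  ... | yes p | _     = inj₁ p
  ... | no _  | yes p = inj₂ p
  ... | no p  | no q  = ⊥-elim (at-most-two i i~x i~y i~z x≢y (p ∘ sym) (q ∘ sym))

  -- The walk from `o` that never turns back.
  walk : ℕ → Fin n
  walk zero          = o
  walk (suc zero)    = proj₁ (two o)
  walk (suc (suc k)) = proj₁ (other (walk (suc k)) (walk k))

  walk-adj : ∀ k → adj G (walk k) (walk (suc k)) ≡ true
  walk-adj zero    = let _ , _ , p , _ = two o in p
  walk-adj (suc k) = proj₁ (proj₂ (other (walk (suc k)) (walk k)))

  walk-turns : ∀ k → walk (suc (suc k)) ≢ walk k
  walk-turns k = proj₂ (proj₂ (other (walk (suc k)) (walk k)))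

  walk-adj⁻ : ∀ k → adj G (walk (suc k)) (walk k) ≡ true
  walk-adj⁻ k = trans (adj-sym G _ _) (walk-adj k)

  walk-neighbours : ∀ k {z} → adj G (walk (suc k)) z ≡ true → z ≡ walk k ⊎ z ≡ walk (suc (suc k))
  walk-neighbours k = other-unique (walk (suc k)) (walk-adj⁻ k) (walk-adj (suc k)) (walk-turns k ∘ sym)

  adjacent≢ : ∀ {x y} → adj G x y ≡ true → x ≢ y
  adjacent≢ {x} x~y refl = Boolₚ.not-¬ (irrefl G x) x~y

  InjectiveUpTo : ℕ → Set
  InjectiveUpTo k = ∀ {i j} → i ℕ.≤ k → j ℕ.≤ k → walk i ≡ walk j → i ≡ j

  -- If the new vertex repeats an interior vertex of the walk, its predecessor is one of the two
  -- walk neighbours of that vertex. By injectivity this leaves only a loop or an immediate turn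
  -- back, and both are excluded.
  first-return : ∀ k → InjectiveUpTo k → ∀ j → j ℕ.≤ k → walk (suc k) ≡ walk j → j ≡ 0
  first-return k inj zero j≤k eq = refl
  first-return zero inj (suc j) () eq
  first-return (suc k) inj (suc j) (s≤s j≤k) eq with walk-neighbours j (subst (λ c → adj G c (walk (suc k)) ≡ true) eq (walk-adj⁻ (suc k)))
  ... | inj₁ p = ⊥-elim (ℕₚ.<-irrefl (sym (inj ℕₚ.≤-refl (ℕₚ.≤-trans j≤k (ℕₚ.n≤1+n k)) p)) (s≤s j≤k))
  ... | inj₂ p with ℕₚ.m≤n⇒m<n∨m≡n j≤k
  ...   | inj₂ refl = ⊥-elim (adjacent≢ (walk-adj (suc k)) (sym eq))
  ...   | inj₁ j<k with inj ℕₚ.≤-refl (s≤s j<k) p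
  ...     | refl = ⊥-elim (walk-turns (suc j) eq)

  extend : ∀ k → InjectiveUpTo k → walk (suc k) ≡ o ⊎ InjectiveUpTo (suc k)
  extend k inj with walk (suc k) ≟ o
  ... | yes p = inj₁ p
  ... | no ≢o = inj₂ inj′
    where
    fresh : ∀ {j} → j ℕ.≤ k → walk (suc k) ≢ walk j
    fresh {j} j≤k eq with first-return k inj j j≤k eq
    ... | refl = ≢o eq
    inj′ : InjectiveUpTo (suc k)
    inj′ {i} {j} i≤ j≤ eq with ℕₚ.m≤n⇒m<n∨m≡n i≤ | ℕₚ.m≤n⇒m<n∨m≡n j≤
    ... | inj₁ (s≤s i≤k) | inj₁ (s≤s j≤k) = inj i≤k j≤k eq
    ... | inj₁ (s≤s i≤k) | inj₂ refl      = ⊥-elim (fresh i≤k (sym eq))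
    ... | inj₂ refl      | inj₁ (s≤s j≤k) = ⊥-elim (fresh j≤k eq)
    ... | inj₂ refl      | inj₂ refl      = refl

  injective-bound : ∀ k → InjectiveUpTo k → suc k ℕ.≤ n
  injective-bound k inj = Finₚ.injective⇒≤ {f = λ (a : Fin (suc k)) → walk (toℕ a)}
    (λ {a} {b} eq → Finₚ.toℕ-injective (inj (ℕₚ.≤-pred (Finₚ.toℕ<n a)) (ℕₚ.≤-pred (Finₚ.toℕ<n b)) eq))

  closes : ∃ λ k → InjectiveUpTo k × walk (suc k) ≡ o
  closes = search n 0 (λ { z≤n z≤n _ → refl }) (ℕₚ.≤-reflexive (sym (ℕₚ.+-identityʳ n)))
    where
    -- Injectivity up to `k` forces `k + 1 ≤ n`, so the fuel cannot run out before the walk returns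
    -- to `o`.
    search : ∀ fuel k → InjectiveUpTo k → n ℕ.≤ fuel ℕ.+ k → ∃ λ k → InjectiveUpTo k × walk (suc k) ≡ o
    search zero k inj n≤ = ⊥-elim (ℕₚ.<-irrefl refl (ℕₚ.≤-trans (injective-bound k inj) n≤))
    search (suc fuel) k inj n≤ with extend k inj
    ... | inj₁ p    = k , inj , p
    ... | inj₂ inj′ = search fuel (suc k) inj′ (subst (n ℕ.≤_) (sym (ℕₚ.+-suc fuel k)) n≤)

  module Closed (k : ℕ) (inj : InjectiveUpTo k) (back : walk (suc k) ≡ o) where

    k≢0 : k ≢ 0
    k≢0 refl = adjacent≢ (walk-adj 0) (sym back)

    k≢1 : k ≢ 1
    k≢1 refl = walk-turns 0 back

    -- `walk-neighbours` covers positive indices only. At `o` the preceding vertex is `walk k`,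
    -- which differs from `walk 1` because `k` is not 1.
    origin-neighbours : ∀ {z} → adj G o z ≡ true → z ≡ walk 1 ⊎ z ≡ walk k
    origin-neighbours = other-unique o (walk-adj 0)
      (subst (λ c → adj G c (walk k) ≡ true) back (walk-adj⁻ k))
      (λ eq → k≢1 (sym (inj (ℕₚ.n≢0⇒n>0 k≢0) ℕₚ.≤-refl eq)))

    Visited : Fin n → Set
    Visited z = ∃ λ j → j ℕ.≤ k × walk j ≡ z

    neighbour-visited : ∀ j → j ℕ.≤ k → ∀ {z} → adj G (walk j) z ≡ true → Visited z
    neighbour-visited zero j≤k o~z with origin-neighbours o~z
    ... | inj₁ p = 1 , ℕₚ.n≢0⇒n>0 k≢0 , sym p
    ... | inj₂ p = k , ℕₚ.≤-refl , sym p
    neighbour-visited (suc j) j<k w~z with walk-neighbours j w~z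
    ... | inj₁ p = j , ℕₚ.<⇒≤ j<k , sym p
    ... | inj₂ p with ℕₚ.m≤n⇒m<n∨m≡n j<k
    ...   | inj₁ 1+j<k = suc (suc j) , 1+j<k , sym p
    ...   | inj₂ refl  = 0 , z≤n , trans (sym back) (sym p)

    -- The visited vertices are closed under adjacency, and the graph is connected.
    all-visited : ∀ z → Visited z
    all-visited z = follow (connected o z) (0 , z≤n , refl)
      where
      follow : ∀ {x} → Reachable G x z → Visited x → Visited z
      follow here v = v
      follow (step x~y path) (j , j≤k , refl) = follow path (neighbour-visited j j≤k x~y)

    index : Fin n → ℕ
    index z = proj₁ (all-visited z)

    index≤k : ∀ z → index z ℕ.≤ k
    index≤k z = proj₁ (proj₂ (all-visited z))

    walk-index : ∀ z → walk (index z) ≡ z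
    walk-index z = proj₂ (proj₂ (all-visited z))

    1+k≡n : suc k ≡ n
    1+k≡n = ℕₚ.≤-antisym (injective-bound k inj)
      (Finₚ.injective⇒≤ {f = λ z → fromℕ< (s≤s (index≤k z))} λ {x} {y} eq →
        trans (sym (walk-index x)) (trans (cong walk (trans (sym (Finₚ.toℕ-fromℕ< (s≤s (index≤k x))))
          (trans (cong toℕ eq) (Finₚ.toℕ-fromℕ< (s≤s (index≤k y)))))) (walk-index y)))

    σ τ : Fin n → Fin n
    σ z = fromℕ< (subst (index z ℕ.<_) 1+k≡n (s≤s (index≤k z)))
    τ a = walk (toℕ a)

    toℕ-σ : ∀ z → toℕ (σ z) ≡ index z
    toℕ-σ z = Finₚ.toℕ-fromℕ< _

    walk-σ : ∀ z → walk (toℕ (σ z)) ≡ z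
    walk-σ z = trans (cong walk (toℕ-σ z)) (walk-index z)

    toℕ≤k : ∀ (a : Fin n) → toℕ a ℕ.≤ k
    toℕ≤k a = ℕₚ.≤-pred (subst (toℕ a ℕ.<_) (sym 1+k≡n) (Finₚ.toℕ<n a))

    στ : ∀ a → σ (τ a) ≡ a
    στ a = Finₚ.toℕ-injective (trans (toℕ-σ (τ a)) (inj (index≤k (τ a)) (toℕ≤k a) (walk-index (τ a))))

    CycSuccℕ : ℕ → ℕ → Set
    CycSuccℕ a b = b ≡ suc a ⊎ (suc a ≡ n × b ≡ 0)

    succ⇒adj : ∀ a b → CycSuccℕ a b → adj G (walk a) (walk b) ≡ true
    succ⇒adj a .(suc a) (inj₁ refl) = walk-adj a
    succ⇒adj a .0 (inj₂ (1+a≡n , refl)) with ℕₚ.suc-injective (trans 1+a≡n (sym 1+k≡n))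
    ... | refl = subst (λ c → adj G (walk k) c ≡ true) back (walk-adj k)

    adj⇒succ : ∀ a b → a ℕ.≤ k → b ℕ.≤ k → adj G (walk a) (walk b) ≡ true → CycSuccℕ a b ⊎ CycSuccℕ b a
    adj⇒succ zero b a≤k b≤k a~b with origin-neighbours a~b
    ... | inj₁ p = inj₁ (inj₁ (inj b≤k (ℕₚ.n≢0⇒n>0 k≢0) p))
    ... | inj₂ p = inj₂ (inj₂ (trans (cong suc (inj b≤k ℕₚ.≤-refl p)) 1+k≡n , refl))
    adj⇒succ (suc a) b a<k b≤k a~b with walk-neighbours a a~b
    ... | inj₁ p = inj₂ (inj₁ (cong suc (sym (inj b≤k (ℕₚ.<⇒≤ a<k) p))))
    ... | inj₂ p with ℕₚ.m≤n⇒m<n∨m≡n a<k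
    ...   | inj₁ 1+a<k = inj₁ (inj₁ (inj b≤k 1+a<k p))
    ...   | inj₂ refl  = inj₁ (inj₂ (1+k≡n , inj b≤k z≤n (trans p back)))

    iso : IsoToCycle G
    iso = σ , τ , στ , walk-σ , λ i j →
      (λ i~j → adj⇒succ (toℕ (σ i)) (toℕ (σ j)) (toℕ≤k (σ i)) (toℕ≤k (σ j))
                 (subst₂ (λ x y → adj G x y ≡ true) (sym (walk-σ i)) (sym (walk-σ j)) i~j)) ,
      λ { (inj₁ s) → subst₂ (λ x y → adj G x y ≡ true) (walk-σ i) (walk-σ j) (succ⇒adj _ _ s)
        ; (inj₂ s) → trans (adj-sym G i j) (subst₂ (λ x y → adj G x y ≡ true) (walk-σ j) (walk-σ i) (succ⇒adj _ _ s)) }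

  iso-to-cycle : IsoToCycle G
  iso-to-cycle = let k , inj , back = closes in Closed.iso k inj back

-- Resistances

module Resistance {n : ℕ} (G : Graph n) (R : Fin n → Fin n → ℚ) (resistance : IsResistanceMatrix G R)
  (T : ℚ) (transmission : ∀ i → ∑ n (R i) ≡ T) (o : Fin n) where

  N : ℚ
  N = ι n

  potential : Fin n → Fin n → Fin n → ℚ
  potential i j = proj₁ (resistance i j)

  L-potential : ∀ i j l → L G (potential i j) l ≡ δ i l - δ j l
  L-potential i j = proj₁ (proj₂ (resistance i j))

  R≡ : ∀ i j → R i j ≡ potential i j i - potential i j j
  R≡ i j = proj₂ (proj₂ (resistance i j))

  pairing : ∀ (y : Fin n → ℚ) i j → ∑ n (λ l → y l * (δ i l - δ j l)) ≡ y i - y j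
  pairing y i j = trans (∑-cong n (λ l → eq (y l) (δ i l) (δ j l)))
    (trans (∑-distrib-minus n (λ l → δ i l * y l) (λ l → δ j l * y l)) (cong₂ _-_ (∑-δ n i y) (∑-δ n j y)))
    where
    eq : ∀ y a b → y * (a - b) ≡ a * y - b * y
    eq = solve-∀ ℚ-ring

  -- Reciprocity: self-adjointness of the Laplacian, with both pairings evaluated at the poles.
  dipoles : ∀ {x y i j i′ j′} → (∀ l → L G x l ≡ δ i l - δ j l) → (∀ l → L G y l ≡ δ i′ l - δ j′ l) →
            y i - y j ≡ x i′ - x j′
  dipoles {x} {y} {i} {j} {i′} {j′} Lx Ly =
    trans (sym (pairing y i j)) (trans (∑-cong n (λ l → cong (y l *_) (sym (Lx l))))
   (trans (L-selfadjoint G x y) (trans (∑-cong n (λ l → cong (x l *_) (Ly l))) (pairing x i′ j′))))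

  -- The Green's function grounded at o.
  g : Fin n → Fin n → ℚ
  g j l = potential j o l - potential j o o

  L-g : ∀ j l → L G (g j) l ≡ δ j l - δ o l
  L-g j l = trans (L-minus G (potential j o) (λ _ → potential j o o) l)
           (trans (cong₂ _-_ (L-potential j o l) (L-const G (potential j o o) l)) (eq (δ j l - δ o l)))
    where
    eq : ∀ x → x - 0ℚ ≡ x
    eq = solve-∀ ℚ-ring

  g-o : ∀ j → g j o ≡ 0ℚ
  g-o j = ℚₚ.+-inverseʳ (potential j o o)

  g-sym : ∀ i j → g i j ≡ g j i
  g-sym i j = trans (ground i j) (trans (dipoles {g j} {g i} (L-g j) (L-g i)) (sym (ground j i)))
    where
    eq : ∀ x → x ≡ x - 0ℚ
    eq = solve-∀ ℚ-ring
    ground : ∀ i j → g i j ≡ g i j - g i o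
    ground i j = trans (eq (g i j)) (cong (λ z → g i j - z) (sym (g-o i)))

  -- `g i - g j` and `potential i j` solve the same dipole equation. Reciprocity equates their
  -- potential differences without an appeal to uniqueness of solutions.
  R≡g : ∀ i j → R i j ≡ g i i - g j i - (g i j - g j j)
  R≡g i j = trans (R≡ i j)
    (dipoles {λ l → g i l - g j l} {potential i j}
      (λ l → trans (L-minus G (g i) (g j) l) (trans (cong₂ _-_ (L-g i l) (L-g j l)) (eq (δ i l) (δ j l) (δ o l))))
      (L-potential i j))
    where
    eq : ∀ a b c → a - c - (b - c) ≡ a - b
    eq = solve-∀ ℚ-ring

  s : Fin n → ℚ
  s i = ∑ n (λ j → g j i)

  C : ℚ
  C = ∑ n (λ j → g j j)

  -- Constancy of the row sums thus determines the diagonal of `g` from the column sums `s`.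
  transmission≡g : ∀ i → T ≡ N * g i i - 2ℚ * s i + C
  transmission≡g i = trans (sym (transmission i))
    (trans (∑-cong n (λ j → trans (R≡g i j) (trans (cong (λ z → g i i - g j i - (z - g j j)) (g-sym i j)) (eq (g i i) (g j i) (g j j)))))
    (trans (∑-distrib-+ n (λ j → g i i - 2ℚ * g j i) (λ j → g j j))
           (cong (_+ C) (trans (∑-distrib-minus n (λ _ → g i i) (λ j → 2ℚ * g j i))
                               (cong₂ _-_ (∑-const n (g i i)) (∑-distribˡ-* n 2ℚ (λ j → g j i)))))))
    where
    eq : ∀ a b c → a - b - (b - c) ≡ a - 2ℚ * b + c
    eq = solve-∀ ℚ-ring

  h : Fin n → Fin n → ℚ
  h i j = N * R i j

  h-diag : ∀ i → h i i ≡ 0ℚ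
  h-diag i = trans (cong (N *_) (trans (R≡ i i) (ℚₚ.+-inverseʳ (potential i i i)))) (ℚₚ.*-zeroʳ N)

  h-sym : ∀ i j → h i j ≡ h j i
  h-sym i j = cong (N *_) (trans (R≡g i j) (trans (eq (g i i) (g j i) (g i j) (g j j)) (sym (R≡g j i))))
    where
    eq : ∀ a b c d → a - b - (c - d) ≡ d - c - (b - a)
    eq = solve-∀ ℚ-ring

  -- Eliminating `g j j` through `transmission≡g` leaves, as a function of `j`, a constant plus
  -- terms whose Laplacians are known.
  h≡ : ∀ i j → h i j ≡ (N * g i i + T - C) + (2ℚ * s j - 2ℚ * N * g i j)
  h≡ i j = trans (cong (N *_) (trans (R≡g i j) (cong (λ z → g i i - z - (g i j - g j j)) (g-sym j i))))
          (trans (eq N (g i i) (g i j) (g j j) (s j) C)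
                 (cong (λ z → (N * g i i + z - C) + (2ℚ * s j - 2ℚ * N * g i j)) (sym (transmission≡g j))))
    where
    eq : ∀ m a b d s c → m * (a - b - (b - d)) ≡ (m * a + (m * d - 2ℚ * s + c) - c) + (2ℚ * s - 2ℚ * m * b)
    eq = solve-∀ ℚ-ring

  L-s : ∀ l → L G s l ≡ 1ℚ - N * δ o l
  L-s l = trans (L-∑ G n g l) (trans (∑-cong n (λ j → L-g j l))
    (trans (∑-distrib-minus n (λ j → δ j l) (λ _ → δ o l))
           (cong₂ _-_ (trans (∑-cong n (λ j → δ-sym j l)) (∑-δ-1 n l)) (∑-const n (δ o l)))))

  -- The contributions of the ground `o` from `s` and from `g i` cancel.
  L-h : ∀ i l → laplacian G (h i) l ≡ 2ℚ - 2ℚ * N * δ i l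
  L-h i l = trans (L-cong G (h≡ i) l)
    (trans (L-+ G (λ _ → N * g i i + T - C) (λ j → 2ℚ * s j - 2ℚ * N * g i j) l)
    (trans (cong₂ _+_ (L-const G (N * g i i + T - C) l)
                      (trans (L-minus G (λ j → 2ℚ * s j) (λ j → 2ℚ * N * g i j) l)
                             (cong₂ _-_ (trans (L-* G 2ℚ s l) (cong (2ℚ *_) (L-s l)))
                                        (trans (L-* G (2ℚ * N) (g i) l) (cong (2ℚ * N *_) (L-g i l))))))
           (eq N (δ o l) (δ i l))))
    where
    eq : ∀ m a b → 0ℚ + (2ℚ * (1ℚ - m * a) - 2ℚ * m * (b - a)) ≡ 2ℚ - 2ℚ * m * b
    eq = solve-∀ ℚ-ring

-- The cycle

-- The right side telescopes: F(x) = x (x - 1) (3 M + 1 - 2 x) satisfies F(x + 1) - F(x) = 6 x (M -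
-- x). The offset `s` is there because `∑` splits off its first term.
∑-quadratic : ∀ M m s → 6ℚ * ∑ m (λ a → (s + ι (toℕ a)) * (M - (s + ι (toℕ a)))) ≡
  (s + ι m) * (s + ι m - 1ℚ) * (3ℚ * M + 1ℚ - 2ℚ * (s + ι m)) - s * (s - 1ℚ) * (3ℚ * M + 1ℚ - 2ℚ * s)
∑-quadratic M zero s = eq M s
  where
  eq : ∀ M s → 6ℚ * 0ℚ ≡ (s + 0ℚ) * (s + 0ℚ - 1ℚ) * (3ℚ * M + 1ℚ - 2ℚ * (s + 0ℚ)) - s * (s - 1ℚ) * (3ℚ * M + 1ℚ - 2ℚ * s)
  eq = solve-∀ ℚ-ring
∑-quadratic M (suc m) s =
  trans (ℚₚ.*-distribˡ-+ 6ℚ ((s + 0ℚ) * (M - (s + 0ℚ))) _)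
 (trans (cong (6ℚ * ((s + 0ℚ) * (M - (s + 0ℚ))) +_)
          (trans (cong (6ℚ *_) (∑-cong m (λ a → cong (λ z → z * (M - z)) (shift s (ι (toℕ a))))))
                 (∑-quadratic M m (s + 1ℚ))))
        (eq M s (ι m)))
  where
  shift : ∀ s x → s + (1ℚ + x) ≡ s + 1ℚ + x
  shift = solve-∀ ℚ-ring
  eq : ∀ M s m → 6ℚ * ((s + 0ℚ) * (M - (s + 0ℚ))) +
    ((s + 1ℚ + m) * (s + 1ℚ + m - 1ℚ) * (3ℚ * M + 1ℚ - 2ℚ * (s + 1ℚ + m)) - (s + 1ℚ) * (s + 1ℚ - 1ℚ) * (3ℚ * M + 1ℚ - 2ℚ * (s + 1ℚ)))
    ≡ (s + (1ℚ + m)) * (s + (1ℚ + m) - 1ℚ) * (3ℚ * M + 1ℚ - 2ℚ * (s + (1ℚ + m))) - s * (s - 1ℚ) * (3ℚ * M + 1ℚ - 2ℚ * s)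
  eq = solve-∀ ℚ-ring

next : ∀ {n} (a : Fin n) → ∃ λ b → CycSucc n a b
next {suc n} a with ℕₚ.m≤n⇒m<n∨m≡n (Finₚ.toℕ<n a)
... | inj₁ 1+a<n = fromℕ< 1+a<n , inj₁ (Finₚ.toℕ-fromℕ< 1+a<n)
... | inj₂ 1+a≡n = zero , inj₂ (1+a≡n , refl)

prev : ∀ {n} (a : Fin n) → ∃ λ b → CycSucc n b a
prev {suc n} zero = fromℕ< (ℕₚ.n<1+n n) , inj₂ (cong suc (Finₚ.toℕ-fromℕ< (ℕₚ.n<1+n n)) , refl)
prev {suc n} (suc a) = fromℕ< (ℕₚ.m<n⇒m<1+n (Finₚ.toℕ<n a)) , inj₁ (cong suc (sym (Finₚ.toℕ-fromℕ< _)))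

next-unique : ∀ {n} {a b c : Fin n} → CycSucc n a b → CycSucc n a c → b ≡ c
next-unique (inj₁ p) (inj₁ q) = Finₚ.toℕ-injective (trans p (sym q))
next-unique {b = b} (inj₁ p) (inj₂ (q , _)) = ⊥-elim (ℕₚ.<-irrefl (trans p q) (Finₚ.toℕ<n b))
next-unique {c = c} (inj₂ (q , _)) (inj₁ p) = ⊥-elim (ℕₚ.<-irrefl (trans p q) (Finₚ.toℕ<n c))
next-unique (inj₂ (_ , p)) (inj₂ (_ , q)) = Finₚ.toℕ-injective (trans p (sym q))

prev-unique : ∀ {n} {a b c : Fin n} → CycSucc n b a → CycSucc n c a → b ≡ c
prev-unique (inj₁ p) (inj₁ q) = Finₚ.toℕ-injective (ℕₚ.suc-injective (trans (sym p) q))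
prev-unique (inj₁ p) (inj₂ (_ , q)) with trans (sym p) q
... | ()
prev-unique (inj₂ (_ , q)) (inj₁ p) with trans (sym p) q
... | ()
prev-unique (inj₂ (p , _)) (inj₂ (q , _)) = Finₚ.toℕ-injective (ℕₚ.suc-injective (trans p (sym q)))

-- Only for n at most 2 can the successor of a position also be its predecessor.
next≢prev : ∀ {n k} → n ≡ 3 ℕ.+ k → {a b c : Fin n} → CycSucc n a b → CycSucc n c a → b ≢ c
next≢prev _ (inj₁ p) (inj₁ q) refl = ℕₚ.<-irrefl (trans q (cong suc p)) (s≤s (ℕₚ.n≤1+n _))
next≢prev n≡ (inj₁ p) (inj₂ (q , r)) refl with trans (sym n≡) (trans (sym q) (cong suc (trans p (cong suc r))))
... | ()
next≢prev n≡ (inj₂ (p , q)) (inj₁ r) refl with trans (sym n≡) (trans (sym p) (cong suc (trans r (cong suc q))))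
... | ()
next≢prev n≡ (inj₂ (p , q)) (inj₂ (r , t)) refl with trans (sym n≡) (trans (sym p) (cong suc t))
... | ()

module Cycle {n k : ℕ} (n≡3+k : n ≡ 3 ℕ.+ k) (G : Graph n) (σ τ : Fin n → Fin n)
  (στ : ∀ a → σ (τ a) ≡ a) (τσ : ∀ i → τ (σ i) ≡ i)
  (iso : ∀ i j → (adj G i j ≡ true → CycAdj n (σ i) (σ j)) × (CycAdj n (σ i) (σ j) → adj G i j ≡ true))
  (o : Fin n) (σo≡0 : toℕ (σ o) ≡ 0) where

  N : ℚ
  N = ι n

  quadratic : ℚ → ℚ
  quadratic x = x * (N - x)

  pos : Fin n → ℚ
  pos a = ι (toℕ a)

  y : Fin n → ℚ
  y j = quadratic (pos (σ j))

  -- Wrapping from n - 1 to 0 goes unnoticed, since the quadratic vanishes at both 0 and n.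
  y-next : ∀ {a b} → CycSucc n a b → quadratic (pos b) ≡ quadratic (1ℚ + pos a)
  y-next (inj₁ p) = cong (quadratic ∘ ι) p
  y-next {a} {b} (inj₂ (p , q)) = trans (cong (quadratic ∘ ι) q)
    (trans (eq N) (cong quadratic (sym (cong ι p))))
    where
    eq : ∀ M → 0ℚ * (M - 0ℚ) ≡ M * (M - M)
    eq = solve-∀ ℚ-ring

  -- The last term is the jump of the quadratic between −1 and its cyclic representative n − 1.
  y-prev : ∀ {b} j → CycSucc n b (σ j) → quadratic (pos b) ≡ quadratic (pos (σ j) - 1ℚ) + 2ℚ * N * δ o j
  y-prev {b} j (inj₁ p) = trans (eq (pos b) N) (cong₂ (λ x d → quadratic (x - 1ℚ) + 2ℚ * N * d) (sym (cong ι p)) (sym (δ-≢ o≢j)))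
    where
    o≢j : o ≢ j
    o≢j refl with trans (sym σo≡0) p
    ... | ()
    eq : ∀ x M → x * (M - x) ≡ (1ℚ + x - 1ℚ) * (M - (1ℚ + x - 1ℚ)) + 2ℚ * M * 0ℚ
    eq = solve-∀ ℚ-ring
  y-prev {b} j (inj₂ (p , q)) = trans (cong (λ M → pos b * (M - pos b)) (sym (cong ι p)))
    (trans (eq (pos b)) (trans (cong (λ M → (0ℚ - 1ℚ) * (M - (0ℚ - 1ℚ)) + 2ℚ * M * 1ℚ) (cong ι p))
    (cong₂ (λ x d → quadratic (x - 1ℚ) + 2ℚ * N * d) (sym (cong ι q)) (sym (trans (cong (δ o) (sym o≡j)) (δ-refl o))))))
    where
    o≡j : o ≡ j
    o≡j = trans (sym (τσ o)) (trans (cong τ (Finₚ.toℕ-injective (trans σo≡0 (sym q)))) (τσ j))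
    eq : ∀ x → x * (1ℚ + x - x) ≡ (0ℚ - 1ℚ) * (1ℚ + x - (0ℚ - 1ℚ)) + 2ℚ * (1ℚ + x) * 1ℚ
    eq = solve-∀ ℚ-ring

  -- The negated second difference of x (n - x) is the constant 2; the jump in `y-prev` supplies the
  -- delta at `o`.
  L-y : ∀ j → L G y j ≡ 2ℚ - 2ℚ * N * δ o j
  L-y j = trans (L-weighted G y j)
    (trans (∑-cong n (λ l → trans (cong (_* (y j - y l)) (w≡ l)) (ℚₚ.*-distribʳ-+ (y j - y l) (δ p l) (δ q l))))
    (trans (∑-distrib-+ n (λ l → δ p l * (y j - y l)) (λ l → δ q l * (y j - y l)))
    (trans (cong₂ _+_ (∑-δ n p (λ l → y j - y l)) (∑-δ n q (λ l → y j - y l)))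
    (trans (cong₂ (λ a b → y j - a + (y j - b)) yp yq) (eq (pos (σ j)) N (δ o j))))))
    where
    b = proj₁ (next (σ j))
    c = proj₁ (prev (σ j))
    j→b = proj₂ (next (σ j))
    c→j = proj₂ (prev (σ j))
    p = τ b
    q = τ c
    p≢q : p ≢ q
    p≢q p≡q = next≢prev n≡3+k j→b c→j (trans (sym (στ b)) (trans (cong σ p≡q) (στ c)))
    yp : y p ≡ quadratic (1ℚ + pos (σ j))
    yp = trans (cong (quadratic ∘ pos) (στ b)) (y-next {σ j} {b} j→b)
    yq : y q ≡ quadratic (pos (σ j) - 1ℚ) + 2ℚ * N * δ o j
    yq = trans (cong (quadratic ∘ pos) (στ c)) (y-prev {c} j c→j)
    neighbour : ∀ l → CycAdj n (σ j) (σ l) → l ≡ p ⊎ l ≡ q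
    neighbour l (inj₁ s) = inj₁ (trans (sym (τσ l)) (cong τ (next-unique s j→b)))
    neighbour l (inj₂ s) = inj₂ (trans (sym (τσ l)) (cong τ (prev-unique s c→j)))
    adj-p : adj G j p ≡ true
    adj-p = proj₂ (iso j p) (inj₁ (subst (CycSucc n (σ j)) (sym (στ b)) j→b))
    adj-q : adj G j q ≡ true
    adj-q = proj₂ (iso j q) (inj₂ (subst (λ z → CycSucc n z (σ j)) (sym (στ c)) c→j))
    w≡ : ∀ l → w G j l ≡ δ p l + δ q l
    w≡ l = by-cases (p ≟ l) (q ≟ l)
      where
      by-cases : Dec (p ≡ l) → Dec (q ≡ l) → w G j l ≡ δ p l + δ q l
      by-cases (yes refl) _ = trans (cong ⟦_⟧ adj-p) (sym (cong₂ _+_ (δ-refl p) (δ-≢ (p≢q ∘ sym))))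
      by-cases (no p≢l) (yes refl) = trans (cong ⟦_⟧ adj-q) (sym (cong₂ _+_ (δ-≢ p≢l) (δ-refl q)))
      by-cases (no p≢l) (no q≢l) = trans (cong ⟦_⟧ (Boolₚ.¬-not not-adj)) (sym (cong₂ _+_ (δ-≢ p≢l) (δ-≢ q≢l)))
        where
        not-adj : adj G j l ≢ true
        not-adj j~l = [ p≢l ∘ sym , q≢l ∘ sym ]′ (neighbour l (proj₁ (iso j l) j~l))
    eq : ∀ x M d → x * (M - x) - (1ℚ + x) * (M - (1ℚ + x)) + (x * (M - x) - ((x - 1ℚ) * (M - (x - 1ℚ)) + 2ℚ * M * d))
                 ≡ 2ℚ - 2ℚ * M * d
    eq = solve-∀ ℚ-ring

  y-o : y o ≡ 0ℚ
  y-o = trans (cong (quadratic ∘ ι) σo≡0) (ℚₚ.*-zeroˡ (N - 0ℚ))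

  ∑-y : 6ℚ * ∑ n y ≡ N * (N * N - 1ℚ)
  ∑-y = trans (cong (6ℚ *_) (∑-reindex n σ τ στ τσ (quadratic ∘ pos)))
       (trans (cong (6ℚ *_) (∑-cong n (λ a → cong quadratic (sym (ℚₚ.+-identityˡ (pos a))))))
       (trans (∑-quadratic N n 0ℚ) (eq N)))
    where
    eq : ∀ M → (0ℚ + M) * (0ℚ + M - 1ℚ) * (3ℚ * M + 1ℚ - 2ℚ * (0ℚ + M)) - 0ℚ * (0ℚ - 1ℚ) * (3ℚ * M + 1ℚ - 2ℚ * 0ℚ) ≡ M * (M * M - 1ℚ)
    eq = solve-∀ ℚ-ring

  -- `h` and `y` have the same Laplacian and both vanish at `o`. Pairing each with the Laplacian of
  -- the other gives twice its own sum, and self-adjointness equates the two.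
  ∑-kernel : ∀ (h : Fin n → ℚ) → h o ≡ 0ℚ → (∀ l → L G h l ≡ 2ℚ - 2ℚ * N * δ o l) → 6ℚ * ∑ n h ≡ N * (N * N - 1ℚ)
  ∑-kernel h ho≡0 L-h = trans (cong (6ℚ *_) (*-cancelˡ-≡ {2ℚ} {∑ n h} {∑ n y} 0<2 ∑h≡∑y)) ∑-y
    where
    eq : ∀ s c → 2ℚ * s - c * 0ℚ ≡ 2ℚ * s
    eq = solve-∀ ℚ-ring
    pair : ∀ (f g : Fin n → ℚ) → f o ≡ 0ℚ → (∀ l → L G g l ≡ 2ℚ - 2ℚ * N * δ o l) → ∑ n (λ l → f l * L G g l) ≡ 2ℚ * ∑ n f
    pair f g fo Lg = trans (∑-cong n (λ l → cong (f l *_) (Lg l)))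
      (trans (∑-*-δ n o (2ℚ * N) f) (trans (cong (λ z → 2ℚ * ∑ n f - 2ℚ * N * z) fo) (eq (∑ n f) (2ℚ * N))))
    ∑h≡∑y : 2ℚ * ∑ n h ≡ 2ℚ * ∑ n y
    ∑h≡∑y = trans (sym (pair h y ho≡0 L-y)) (trans (L-selfadjoint G y h) (pair y h y-o L-h))

-- The bound 6 / (n² − 1)

toℚᵘ-ι : ∀ n → ℚ.toℚᵘ (ι n) ℚᵘ.≃ mkℚᵘ (ℤ.+ n) 0
toℚᵘ-ι zero    = ℚᵘₚ.≃-refl
toℚᵘ-ι (suc n) = ℚᵘₚ.≃-trans (ℚₚ.toℚᵘ-homo-+ 1ℚ (ι n))
  (ℚᵘₚ.≃-trans (ℚᵘₚ.+-congʳ (ℚ.toℚᵘ 1ℚ) (toℚᵘ-ι n)) (*≡* (cong (ℤ._* ℤ.+ 1) (cong (λ z → ℤ.+ 1 ℤ.+ z) (ℤₚ.*-identityʳ (ℤ.+ n))))))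

ι-+ : ∀ m n → ι (m ℕ.+ n) ≡ ι m + ι n
ι-+ zero    n = sym (ℚₚ.+-identityˡ (ι n))
ι-+ (suc m) n = trans (cong (1ℚ +_) (ι-+ m n)) (sym (ℚₚ.+-assoc 1ℚ (ι m) (ι n)))

ι-* : ∀ m n → ι (m ℕ.* n) ≡ ι m * ι n
ι-* zero    n = sym (ℚₚ.*-zeroˡ (ι n))
ι-* (suc m) n = trans (ι-+ n (m ℕ.* n)) (trans (cong (λ z → ι n + z) (ι-* m n)) (eq (ι m) (ι n)))
  where
  eq : ∀ a b → b + a * b ≡ (1ℚ + a) * b
  eq = solve-∀ ℚ-ring

-- The quotient `_/_` is stored in lowest terms, so the cross-multiplication is done on unnormalised
-- rationals.
6/d*ιd : ∀ d → ((ℤ.+ 6) / suc d) * ι (suc d) ≡ 6ℚ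
6/d*ιd d = ℚₚ.toℚᵘ-injective
  (ℚᵘₚ.≃-trans (ℚₚ.toℚᵘ-homo-* ((ℤ.+ 6) / suc d) (ι (suc d)))
  (ℚᵘₚ.≃-trans (ℚᵘₚ.*-cong (ℚₚ.toℚᵘ-fromℚᵘ (mkℚᵘ (ℤ.+ 6) d)) (toℚᵘ-ι (suc d)))
               (*≡* (trans (ℤₚ.*-identityʳ _) (cong (λ z → ℤ.+ 6 ℤ.* ℤ.+ z) (sym (ℕₚ.*-identityʳ (suc d))))))))

cycleBound-spec : ∀ k → cycleBound (3 ℕ.+ k) * (ι (3 ℕ.+ k) * ι (3 ℕ.+ k) - 1ℚ) ≡ 6ℚ
-- `6/d*ιd` takes the predecessor of the denominator n² - 1, hence `∸ 2`.
cycleBound-spec k = trans (cong (cycleBound n *_) (sym ι≡)) (6/d*ιd (n ℕ.* n ∸ 2))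
  where
  n = 3 ℕ.+ k
  eq : ∀ x → x ≡ 1ℚ + x - 1ℚ
  eq = solve-∀ ℚ-ring
  ι≡ : ι (n ℕ.* n ∸ 1) ≡ ι n * ι n - 1ℚ
  ι≡ = trans (eq (ι (n ℕ.* n ∸ 1))) (cong (_- 1ℚ) (ι-* n n))

-- From row sums of the resistance matrix to the curvature bound and its equality case.

module Curvature {n k : ℕ} (n≡3+k : n ≡ 3 ℕ.+ k) (G : Graph n) (connected : Connected G)
  (R : Fin n → Fin n → ℚ) (resistance : IsResistanceMatrix G R)
  (K : ℚ) (curvature : ∀ i → K * ∑ n (R i) ≡ 1ℚ) where

  N D T : ℚ
  N = ι n
  D = N * N - 1ℚ

  o : Fin n
  o = proj₁ (three-distinct n≡3+k)

  T = ∑ n (R o)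

  -- All row sums are inverse to the same `K`; multiplying by `K * T = 1` avoids division.
  transmission : ∀ i → ∑ n (R i) ≡ T
  transmission i = trans (sym (ℚₚ.*-identityˡ (∑ n (R i))))
    (trans (cong (_* ∑ n (R i)) (sym (curvature o)))
    (trans (eq K T (∑ n (R i)))
    (trans (cong (T *_) (curvature i)) (ℚₚ.*-identityʳ T))))
    where
    eq : ∀ a b c → a * b * c ≡ b * (a * c)
    eq = solve-∀ ℚ-ring

  open Resistance G R resistance T transmission o using (h; h-diag; h-sym; L-h)
  open Kernel n≡3+k G connected h h-diag h-sym L-h using (0≤h; module Levels)

  m : ℚ
  m = ι (2 ℕ.+ k)

  N≡1+m : N ≡ 1ℚ + m
  N≡1+m = cong ι n≡3+k

  0<N : 0ℚ < N
  0<N = subst (0ℚ <_) (sym N≡1+m) (0<1+x (0≤ι (2 ℕ.+ k)))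

  0<D : 0ℚ < D
  -- With x = n - 2, the quantity n² - 1 equals 1 + (x (4 + x) + 2).
  0<D = subst (0ℚ <_) (trans (eq (ι (suc k))) (cong (λ z → z * z - 1ℚ) (sym N≡1+m))) (0<1+x (+-nonneg (*-nonneg (0≤ι (suc k)) (+-nonneg 0≤4 (0≤ι (suc k)))) 0≤2))
    where
    0≤4 : 0ℚ ≤ℚ 2ℚ + 2ℚ
    0≤4 = +-nonneg 0≤2 0≤2
    eq : ∀ x → 1ℚ + (x * (2ℚ + 2ℚ + x) + 2ℚ) ≡ (1ℚ + (1ℚ + x)) * (1ℚ + (1ℚ + x)) - 1ℚ
    eq = solve-∀ ℚ-ring

  cubic≡ : cubic m ≡ N * D
  cubic≡ = trans (eq m) (cong (λ z → z * (z * z - 1ℚ)) (sym N≡1+m))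
    where
    eq : ∀ m → m * (m + 1ℚ) * (m + 2ℚ) ≡ (1ℚ + m) * ((1ℚ + m) * (1ℚ + m) - 1ℚ)
    eq = solve-∀ ℚ-ring

  ∑h≡NT : ∀ i → ∑ n (h i) ≡ N * T
  ∑h≡NT i = trans (∑-distribˡ-* n N (R i)) (cong (N *_) (transmission i))

  6∑h≡ : ∀ i → 6ℚ * ∑ n (h i) ≡ N * (6ℚ * T)
  6∑h≡ i = trans (cong (6ℚ *_) (∑h≡NT i)) (eq N T)
    where
    eq : ∀ a b → 6ℚ * (a * b) ≡ a * (6ℚ * b)
    eq = solve-∀ ℚ-ring

  6T≤D : 6ℚ * T ≤ℚ D
  6T≤D = *-cancelˡ-≤ 0<N (subst₂ _≤ℚ_ (6∑h≡ o) cubic≡ (Levels.total≤ o))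

  0≤T : 0ℚ ≤ℚ T
  0≤T = *-cancelˡ-≤ 0<N (subst₂ _≤ℚ_ (sym (ℚₚ.*-zeroʳ N)) (∑h≡NT o) (∑-nonneg n (0≤h o)))

  0≤K : 0ℚ ≤ℚ K
  0≤K with ℚₚ.≤-total 0ℚ K
  ... | inj₁ p = p
  ... | inj₂ K≤0 = ⊥-elim (ℚₚ.<-irrefl refl (ℚₚ.<-≤-trans 0<1 1≤0))
    where
    eq : ∀ a b → 0ℚ - a * b ≡ (0ℚ - a) * b
    eq = solve-∀ ℚ-ring
    1≤0 : 1ℚ ≤ℚ 0ℚ
    1≤0 = subst (_≤ℚ 0ℚ) (curvature o) (≤-from-gap (*-nonneg (x≤y⇒0≤y-x K≤0) 0≤T) (eq K T))

  D*bound≡6 : D * cycleBound n ≡ 6ℚ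
  D*bound≡6 = trans (ℚₚ.*-comm D (cycleBound n))
    (subst (λ n → cycleBound n * (ι n * ι n - 1ℚ) ≡ 6ℚ) (sym n≡3+k) (cycleBound-spec k))

  6TK≡6 : 6ℚ * T * K ≡ 6ℚ
  6TK≡6 = trans (eq T K) (trans (cong (6ℚ *_) (curvature o)) (ℚₚ.*-identityʳ 6ℚ))
    where
    eq : ∀ a b → 6ℚ * a * b ≡ 6ℚ * (b * a)
    eq = solve-∀ ℚ-ring

  -- Multiplying `6 T ≤ D` by the nonnegative `K` gives 6 ≤ D K, and 6 is also `D * cycleBound n`.
  bound≤K : cycleBound n ≤ℚ K
  bound≤K = *-cancelˡ-≤ 0<D (subst (_≤ℚ D * K) (trans 6TK≡6 (sym D*bound≡6))
    (ℚₚ.*-monoʳ-≤-nonNeg K {{ℚ.nonNegative 0≤K}} 6T≤D))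

  -- At the bound, D = D K T = 6 T, so `total≤` is an equality at every vertex and the graph is
  -- 2-regular.
  K≡bound⇒cycle : K ≡ cycleBound n → IsoToCycle G
  K≡bound⇒cycle K≡ = TwoRegular.iso-to-cycle G connected o (λ i → Levels.two-neighbours i)
    (λ i → Levels.at-most-two-neighbours i (trans (6∑h≡ i) (trans (cong (N *_) 6T≡D) (sym cubic≡))))
    where
    eq : ∀ a b c → a * (b * c) ≡ a * b * c
    eq = solve-∀ ℚ-ring
    6T≡D : 6ℚ * T ≡ D
    6T≡D = sym (trans (sym (ℚₚ.*-identityʳ D)) (trans (cong (D *_) (sym (curvature o)))
      (trans (eq D K T) (cong (_* T) (trans (cong (D *_) K≡) D*bound≡6)))))

  -- All row sums agree, so it suffices to evaluate the one at the vertex in position 0.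
  cycle⇒K≡bound : IsoToCycle G → K ≡ cycleBound n
  cycle⇒K≡bound (σ , τ , στ , τσ , iso) = *-cancelˡ-≡ 0<D
    (trans (cong (_* K) (sym 6T≡D)) (trans 6TK≡6 (sym D*bound≡6)))
    where
    origin : ∃ λ (a : Fin n) → toℕ a ≡ 0
    origin = subst (λ n → ∃ λ (a : Fin n) → toℕ a ≡ 0) (sym n≡3+k) (zero , refl)
    v = τ (proj₁ origin)
    σv≡0 : toℕ (σ v) ≡ 0
    σv≡0 = trans (cong toℕ (στ (proj₁ origin))) (proj₂ origin)
    6T≡D : 6ℚ * T ≡ D
    6T≡D = *-cancelˡ-≡ 0<N (trans (sym (6∑h≡ v))
      (Cycle.∑-kernel n≡3+k G σ τ στ τσ iso v σv≡0 (h v) (h-diag v) (L-h v)))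

theorem2p7 : (n : ℕ) → 3 ≤ n → (G : Graph n) → Connected G →
    (R : Fin n → Fin n → ℚ) → IsResistanceMatrix G R →
    (κ : Fin n → ℚ) → IsCurvature R κ →
    (K : ℚ) → (∀ i → κ i ≡ K) →
    (cycleBound n ≤ℚ K) × ((K ≡ cycleBound n → IsoToCycle G) × (IsoToCycle G → K ≡ cycleBound n))
theorem2p7 n 3≤n G connected R resistance κ curvature K κ≡K = bound≤K , K≡bound⇒cycle , cycle⇒K≡bound
  where
  k,3+k≡n = ℕₚ.m≤n⇒∃[o]m+o≡n 3≤n
  K∑R≡1 : ∀ i → K * ∑ n (R i) ≡ 1ℚ
  K∑R≡1 i = trans (sym (∑-distribˡ-* n K (R i)))
    (trans (∑-cong n (λ j → trans (ℚₚ.*-comm K (R i j)) (cong (R i j *_) (sym (κ≡K j))))) (curvature i))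
  open Curvature (sym (proj₂ k,3+k≡n)) G connected R resistance K K∑R≡1
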